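{- Let $\mathbf{u}$ be a uniformly recurrent infinite word over a finite alphabet $\mathcal{A}$ with $\#\mathcal{A}=k$, and assume that the factor complexity of $\mathbf{u}$ satisfies $\mathcal{C}(n)=(k-1)n+1$ for all $n\in\mathbb{N}$. If every palindrome in $\mathcal{L}(\mathbf{u})$ has a unique palindromic extension in $\mathbf{u}$, then every factor of $\mathbf{u}$ has exactly $k$ return words.
   Context: An infinite word over a finite alphabet $\mathcal{A}$ is a one-sided infinite sequence $\mathbf{u}=u_0u_1u_2\ldots$ of letters of $\mathcal{A}$ in which every letter of $\mathcal{A}$ occurs. Its language $\mathcal{L}(\mathbf{u})$ is the set of all its finite factors (contiguous subwords), including the empty word; $\mathcal{C}(n)$ is the number of distinct factors of length $n$; $\mathbb{N}$ includes $0$. An occurrence of a factor $w$ is an index $i$ such that $w$ is a prefix of $u_iu_{i+1}u_{i+2}\ldots$. $\mathbf{u}$ is recurrent if every factor has at least two (equivalently infinitely many) occurrences, and uniformly recurrent if, moreover, for every factor $w$ the distances between successive occurrences of $w$ are bounded. If $i<j$ are two successive occurrences of $w$ in $\mathbf{u}$, the word $u_iu_{i+1}\cdots u_{j-1}$ is a return word of $w$; the return words of $w$ are counted as distinct words. A word is a palindrome if it equals its reversal (the empty word is a palindrome). For a palindrome $w\in\mathcal{L}(\mathbf{u})$, a palindromic extension of $w$ is a word $awa\in\mathcal{L}(\mathbf{u})$ with $a\in\mathcal{A}$. -}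

module Defs where

open import Data.List using (List; []; _∷_; [_]; _++_; length; reverse; applyUpTo)
open import Data.List.Membership.Propositional using (_∈_)
open import Data.List.Relation.Unary.Unique.Propositional using (Unique)
open import Data.Nat using (ℕ; _+_; _∸_; _≤_; _<_)
open import Data.Product using (∃!; ∃-syntax; _×_)
open import Function.Bundles using (_⇔_)
open import Level using (Level)
open import Relation.Binary.PropositionalEquality using (_≡_)
open import Relation.Nullary using (¬_)
open import Relation.Unary using (Pred)

private
  variable
    a p : Level
    A : Set a

-- A predicate has cardinality n when its elements, up to propositional
-- equality and irrespective of proofs, are listed without repetition by a
-- list of length n.
HasCardinality : {A : Set a} → Pred A p → ℕ → Set _
HasCardinality P n =
  ∃[ xs ] Unique xs × length xs ≡ n × (∀ x → x ∈ xs ⇔ P x)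

-- The factor u i ⋯ u (i + n ∸ 1).
factorAt : (ℕ → A) → ℕ → ℕ → List A
factorAt u i n = applyUpTo (λ l → u (i + l)) n

OccursAt : (ℕ → A) → List A → ℕ → Set _
OccursAt u w i = factorAt u i (length w) ≡ w

Language : (ℕ → A) → Pred (List A) _
Language u w = ∃[ i ] OccursAt u w i

FactorOfLength : (ℕ → A) → ℕ → Pred (List A) _
FactorOfLength u n w = length w ≡ n × Language u w

-- C(n) = m, where C is the factor complexity of u.
Complexity : (ℕ → A) → ℕ → ℕ → Set _
Complexity u n m = HasCardinality (FactorOfLength u n) m

Recurrent : (ℕ → A) → Set _
Recurrent u =
  ∀ w → Language u w → ∃[ i ] ∃[ j ] i < j × OccursAt u w i × OccursAt u w j

SuccessiveOccurrences : (ℕ → A) → List A → ℕ → ℕ → Set _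
SuccessiveOccurrences u w i j =
  i < j × OccursAt u w i × OccursAt u w j ×
  (∀ l → i < l → l < j → ¬ OccursAt u w l)

UniformlyRecurrent : (ℕ → A) → Set _
UniformlyRecurrent u =
  Recurrent u ×
  (∀ w → Language u w →
    ∃[ B ] (∀ i j → SuccessiveOccurrences u w i j → j ∸ i ≤ B))

ReturnWord : (ℕ → A) → List A → Pred (List A) _
ReturnWord u w v =
  ∃[ i ] ∃[ j ] SuccessiveOccurrences u w i j × v ≡ factorAt u i (j ∸ i)

Palindrome : Pred (List A) _
Palindrome w = w ≡ reverse w

PalindromicExtension : (ℕ → A) → List A → Pred (List A) _
PalindromicExtension u w v =
  ∃[ a ] v ≡ a ∷ w ++ [ a ] × Language u v

UniquePalindromicExtensions : (ℕ → A) → Set _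
UniquePalindromicExtensions u =
  ∀ w → Language u w → Palindrome w → ∃! _≡_ (PalindromicExtension u w)

{-# OPTIONS --safe #-}
module Submission where

-- Arbitrarily long palindromes and uniform recurrence make the language closed under reversal.  Consider the graph
-- whose vertices are the factors of length n up to reversal and whose edges are the non-palindromic factors of
-- length n + 1 up to reversal.  It is connected by the walk along u, and counting palindromes and factors shows that
-- it has no edge to spare: it is a tree.  Hence the walk leaves and re-enters a vertex through the same edge
-- (next-class), that is, each occurrence of s or reverse s, read with the letter after it, is the mirror image of the
-- next such occurrence, read with the letter before it.  Following these occurrences, the extension graph of every
-- factor s is seen to be connected, so s has at least #(xs) + #(sy) - 1 two-sided extensions xsy; as the second
-- difference of the complexity vanishes, equality holds for every s.
--
-- Given that equality, the number of right extensions minus 1 is additive over left extensions.  Sorting the words of a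
-- large length by the last occurrence of w in them thus turns the growth rate k - 1 of the complexity into a sum over
-- the words beginning with their only occurrence of w, and that sum is the number of return words of w minus 1.

open import Data.Bool using (Bool; true; false; _∧_; _∨_; not; T; T?; if_then_else_)
open import Data.Bool.Properties using (T-≡; ∨-assoc)
open import Data.Fin using (Fin)
import Data.Fin.Properties as Fin
open import Data.List using (List; []; _∷_; [_]; _++_; map; filter; length; reverse; take; drop; applyUpTo)
open import Data.List.Membership.Propositional using (_∈_)
open import Data.List.Membership.Propositional.Properties
open import Data.List.Properties
open import Data.List.Relation.Unary.All as All using (All; []; _∷_)
open import Data.List.Relation.Unary.AllPairs using ([]; _∷_)
open import Data.List.Relation.Unary.Any as Any using (here; there)
open import Data.List.Relation.Unary.Unique.Propositional using (Unique)
open import Data.List.Relation.Unary.Unique.Propositional.Properties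
  using (filter⁺; Unique[x∷xs]⇒x∉xs; map⁺; map⁻; ++⁺)
open import Data.Nat hiding (_≟_)
open import Data.Nat.ListAction using (sum)
open import Data.Nat.Properties hiding (_≟_)
open import Data.Nat.Tactic.RingSolver using (solve-∀)
open import Data.Product as Product hiding (map)
open import Data.Sum using (_⊎_; inj₁; inj₂)
import Data.Sum.Properties as Sum
open import Function using (_∘_; id)
open import Function.Bundles using (Equivalence; Inverse; _↔_; mk⇔)
open import Function.Definitions using (StrictlySurjective)
open import Function.Properties.Inverse using (↔⇒↣)
open import Relation.Binary.Definitions using (DecidableEquality)
open import Relation.Binary.PropositionalEquality hiding ([_])
open import Relation.Nullary
open import Relation.Nullary.Decidable using (via-injection; dec-true; dec-false)
open import Relation.Unary using (Decidable; Pred)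
open import Defs

-- Duplicate-free lists and orbit representatives of a free involution.

module _ {v} {V : Set v} (_≟_ : DecidableEquality V) where

  Unique-⊆⇒length≤ : ∀ {xs ys : List V} → Unique xs → (∀ {x} → x ∈ xs → x ∈ ys) → length xs ≤ length ys
  Unique-⊆⇒length≤ {[]} _ _ = z≤n
  Unique-⊆⇒length≤ {x ∷ xs} {ys} uq@(_ ∷ uxs) sub = ≤-trans
    (s≤s (Unique-⊆⇒length≤ uxs λ {y} y∈ →
      ∈-filter⁺ (λ z → ¬? (z ≟ x)) (sub (there y∈)) λ { refl → Unique[x∷xs]⇒x∉xs uq y∈ }))
    (filter-notAll (λ z → ¬? (z ≟ x)) ys (Any.map (λ { refl ¬p → ¬p refl }) (sub (here refl))))

  ¬both? : ∀ x y → Decidable (λ z → ¬ z ≡ x × ¬ z ≡ y)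
  ¬both? x y z = ¬? (z ≟ x) ×-dec ¬? (z ≟ y)

  length-remove₂ : ∀ {xs x y} → Unique xs → x ∈ xs → y ∈ xs → x ≢ y →
    2 + length (filter (¬both? x y) xs) ≤ length xs
  length-remove₂ {xs} {x} {y} u x∈ y∈ x≢y = Unique-⊆⇒length≤
    ((x≢y ∷ All.tabulate (λ z∈ x≡z → proj₁ (proj₂ (∈-filter⁻ (¬both? x y) {xs = xs} z∈)) (sym x≡z)))
      ∷ (All.tabulate (λ z∈ y≡z → proj₂ (proj₂ (∈-filter⁻ (¬both? x y) {xs = xs} z∈)) (sym y≡z)))
      ∷ filter⁺ (¬both? x y) u)
    λ { (here refl) → x∈ ; (there (here refl)) → y∈
      ; (there (there z∈)) → proj₁ (∈-filter⁻ (¬both? x y) {xs = xs} z∈) }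

  remove₂-∈ : ∀ {xs x y z} → z ∈ xs → z ≡ x ⊎ z ≡ y ⊎ z ∈ filter (¬both? x y) xs
  remove₂-∈ {x = x} {y} {z} z∈ with z ≟ x | z ≟ y
  ... | yes p | _     = inj₁ p
  ... | no _  | yes q = inj₂ (inj₁ q)
  ... | no p  | no q  = inj₂ (inj₂ (∈-filter⁺ (¬both? x y) z∈ (p , q)))

  module _ (r : V → V) (r-inv : ∀ x → r (r x) ≡ x) where

    FreeOn : List V → Set v
    FreeOn xs = ∀ {x} → x ∈ xs → r x ∈ xs × x ≢ r x

    FreeOn-remove : ∀ {xs x} → FreeOn xs → FreeOn (filter (¬both? x (r x)) xs)
    FreeOn-remove {xs} {x} free z∈ with ∈-filter⁻ (¬both? x (r x)) {xs = xs} z∈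
    ... | z∈xs , z≢x , z≢rx =
      ∈-filter⁺ (¬both? x (r x)) (proj₁ (free z∈xs))
        ( (λ rz≡x → z≢rx (trans (sym (r-inv _)) (cong r rz≡x)))
        , (λ rz≡rx → z≢x (trans (sym (r-inv _)) (trans (cong r rz≡rx) (r-inv _)))))
      , proj₂ (free z∈xs)

    Transversal : List V → List V → Set v
    Transversal xs ys = 2 * length ys ≤ length xs × (∀ {x} → x ∈ xs → x ∈ ys ⊎ r x ∈ ys)

    -- Keep the head and discard its orbit of two elements. A length bound `n` drives the recursion
    -- because the filtered list is not structurally smaller.
    transversal : ∀ {xs} → Unique xs → FreeOn xs → ∃ (Transversal xs)
    transversal {xs} = go (length xs) xs ≤-refl
      where
      go : ∀ n xs → length xs ≤ n → Unique xs → FreeOn xs → ∃ (Transversal xs)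
      go _ [] _ _ _ = [] , z≤n , λ ()
      go (suc n) xs@(x ∷ _) len u free with free (here refl)
      ... | rx∈ , x≢rx with go n (filter (¬both? x (r x)) xs)
                (≤-pred (≤-trans (≤-trans (n≤1+n _) (length-remove₂ u (here refl) rx∈ x≢rx)) len))
                (filter⁺ (¬both? x (r x)) u) (FreeOn-remove free)
      ... | ys , 2ys≤ , cover = x ∷ ys , bound , cover′
        where
        bound : 2 * length (x ∷ ys) ≤ length xs
        bound = ≤-trans (≤-reflexive (*-suc 2 (length ys)))
          (≤-trans (+-monoʳ-≤ 2 2ys≤) (length-remove₂ u (here refl) rx∈ x≢rx))
        cover′ : ∀ {z} → z ∈ xs → z ∈ x ∷ ys ⊎ r z ∈ x ∷ ys
        cover′ z∈ with remove₂-∈ {x = x} {r x} z∈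
        ... | inj₁ refl = inj₁ (here refl)
        ... | inj₂ (inj₁ refl) = inj₂ (here (r-inv x))
        ... | inj₂ (inj₂ z∈′) with cover z∈′
        ... | inj₁ p = inj₁ (there p)
        ... | inj₂ p = inj₂ (there p)

  -- Edge count of a connected graph.

  private
    merge : V → V → V → V
    merge s t x with x ≟ t
    ... | yes _ = s
    ... | no _  = x

    merge-target : ∀ s t → merge s t t ≡ s
    merge-target s t with t ≟ t
    ... | yes _ = refl
    ... | no t≢t = contradiction refl t≢t

    merge-source : ∀ s t → merge s t s ≡ s
    merge-source s t with s ≟ t
    ... | yes _ = refl
    ... | no _  = refl

    merge-other : ∀ {s t x} → x ≢ t → merge s t x ≡ x
    merge-other {s} {t} {x} x≢t with x ≟ t
    ... | yes x≡t = contradiction x≡t x≢t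
    ... | no _  = refl

  -- Connectivity of the graph (xs , es): every vertex labelling that is constant along the edges is constant.
  Connected : List V → List (V × V) → Set v
  Connected xs es = ∀ (f : V → V) → (∀ {x y} → (x , y) ∈ es → f x ≡ f y) →
    ∀ {x y} → x ∈ xs → y ∈ xs → f x ≡ f y

  -- Contract the first edge.
  connected⇒length≤′ : ∀ n es {xs} → length es ≡ n → Unique xs → Connected xs es → length xs ≤ suc n
  connected⇒length≤′ zero [] {[]} _ _ _ = z≤n
  connected⇒length≤′ zero [] {x ∷ []} _ _ _ = ≤-refl
  -- Without edges the identity is an admissible labelling, and it separates distinct vertices.
  connected⇒length≤′ zero [] {x ∷ y ∷ xs} _ ((x≢y ∷ _) ∷ _) conn =
    contradiction (conn id (λ ()) (here refl) (there (here refl))) x≢y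
  connected⇒length≤′ (suc n) ((s , t) ∷ es) {xs} len u conn = begin
    length xs              ≤⟨ Unique-⊆⇒length≤ u xs⊆ ⟩
    suc (length xs′)       ≤⟨ s≤s (connected⇒length≤′ n es′ len′ (filter⁺ ≢t? u) conn′) ⟩
    2 + n                  ∎
    where
    open ≤-Reasoning
    g = merge s t
    es′ = map (λ (x , y) → g x , g y) es
    len′ = trans (length-map _ es) (suc-injective len)
    ≢t? : Decidable (_≢ t)
    ≢t? x = ¬? (x ≟ t)
    xs′ = filter ≢t? xs
    xs⊆ : ∀ {x} → x ∈ xs → x ∈ t ∷ xs′
    xs⊆ {x} x∈ with x ≟ t
    ... | yes refl = here refl
    ... | no x≢t   = there (∈-filter⁺ ≢t? x∈ x≢t)
    -- A labelling of the contracted graph pulls back along `g` to the original one; on vertices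
    -- other than `t` nothing changes.
    conn′ : Connected xs′ es′
    conn′ f f-es′ {x} {y} x∈ y∈ with ∈-filter⁻ ≢t? {xs = xs} x∈ | ∈-filter⁻ ≢t? {xs = xs} y∈
    ... | x∈xs , x≢t | y∈xs , y≢t =
      trans (cong f (sym (merge-other x≢t))) (trans (conn (f ∘ g) f∘g-es x∈xs y∈xs) (cong f (merge-other y≢t)))
      where
      f∘g-es : ∀ {x y} → (x , y) ∈ (s , t) ∷ es → f (g x) ≡ f (g y)
      f∘g-es (here refl) = cong f (trans (merge-source s t) (sym (merge-target s t)))
      f∘g-es (there p)   = f-es′ (∈-map⁺ _ p)

  connected⇒length≤ : ∀ es {xs} → Unique xs → Connected xs es → length xs ≤ suc (length es)
  connected⇒length≤ es = connected⇒length≤′ (length es) es refl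

-- Finite sums over lists.

module _ {x} {X : Set x} where

  ∑ : List X → (X → ℕ) → ℕ
  ∑ xs f = sum (map f xs)

  ∑-cong : ∀ xs {f g} → (∀ {x} → x ∈ xs → f x ≡ g x) → ∑ xs f ≡ ∑ xs g
  ∑-cong []       _   = refl
  ∑-cong (x ∷ xs) f≗g = cong₂ _+_ (f≗g (here refl)) (∑-cong xs (f≗g ∘ there))

  ∑-distrib-+ : ∀ xs f g → ∑ xs (λ x → f x + g x) ≡ ∑ xs f + ∑ xs g
  ∑-distrib-+ []       f g = refl
  ∑-distrib-+ (x ∷ xs) f g =
    trans (cong ((f x + g x) +_) (∑-distrib-+ xs f g)) (interchange (f x) (g x) (∑ xs f) (∑ xs g))
    where
    interchange : ∀ a b c d → (a + b) + (c + d) ≡ (a + c) + (b + d)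
    interchange = solve-∀

  ∑-one : ∀ xs → ∑ xs (λ _ → 1) ≡ length xs
  ∑-one []       = refl
  ∑-one (x ∷ xs) = cong suc (∑-one xs)

  ∑-zero : ∀ xs {f} → (∀ {x} → x ∈ xs → f x ≡ 0) → ∑ xs f ≡ 0
  ∑-zero []       _   = refl
  ∑-zero (x ∷ xs) f≗0 = cong₂ _+_ (f≗0 (here refl)) (∑-zero xs (f≗0 ∘ there))

  ∑-mono-≤ : ∀ xs {f g} → (∀ {x} → x ∈ xs → f x ≤ g x) → ∑ xs f ≤ ∑ xs g
  ∑-mono-≤ []       _   = z≤n
  ∑-mono-≤ (x ∷ xs) f≤g = +-mono-≤ (f≤g (here refl)) (∑-mono-≤ xs (f≤g ∘ there))

  -- If the totals compare the other way, no single term has slack. This upgrades `not-weak` to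
  -- `neutral`.
  ∑-tight : ∀ xs {f g} → (∀ {x} → x ∈ xs → f x ≤ g x) → ∑ xs g ≤ ∑ xs f →
    ∀ {x} → x ∈ xs → f x ≡ g x
  ∑-tight (x ∷ xs) {f} {g} f≤g ∑g≤∑f = λ
    { (here refl) → ≤-antisym (f≤g (here refl))
        (+-cancelʳ-≤ (∑ xs g) _ _ (≤-trans ∑g≤∑f (+-monoʳ-≤ (f x) (∑-mono-≤ xs (f≤g ∘ there)))))
    ; (there x∈) → ∑-tight xs (f≤g ∘ there)
        (+-cancelˡ-≤ (g x) _ _ (≤-trans ∑g≤∑f (+-monoˡ-≤ (∑ xs f) (f≤g (here refl))))) x∈ }

  ∑-single : ∀ {xs x₀} f → Unique xs → x₀ ∈ xs → (∀ {x} → x ≢ x₀ → f x ≡ 0) → ∑ xs f ≡ f x₀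
  ∑-single {x ∷ xs} {x₀} f uq (here refl) off = trans
    (cong (f x₀ +_) (∑-zero xs (λ { x∈ → off (λ { refl → Unique[x∷xs]⇒x∉xs uq x∈ }) })))
    (+-identityʳ _)
  ∑-single {x ∷ xs} f uq@(_ ∷ uxs) (there x₀∈) off =
    cong₂ _+_ (off λ { refl → Unique[x∷xs]⇒x∉xs uq x₀∈ }) (∑-single f uxs x₀∈ off)

module _ {x y} {X : Set x} {Y : Set y} (_≟_ : DecidableEquality Y) where

  fiber : (X → Y) → List X → Y → List X
  fiber φ xs y = filter (λ x → φ x ≟ y) xs

  -- Groups the terms by the value of `φ`. With `g` constantly 1 it counts words by their tail,
  -- prefix or middle.
  ∑-fiber : ∀ {ys} (φ : X → Y) (g : Y → ℕ) xs → Unique ys → (∀ {x} → x ∈ xs → φ x ∈ ys) →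
    ∑ xs (g ∘ φ) ≡ ∑ ys (λ y → g y * length (fiber φ xs y))
  ∑-fiber {ys} φ g [] u _ = sym (∑-zero ys (λ {y} _ → *-zeroʳ (g y)))
  ∑-fiber {ys} φ g (x ∷ xs) u φ∈ = sym (begin
    ∑ ys (λ y → g y * length (fiber φ (x ∷ xs) y))
      ≡⟨ ∑-cong ys (λ {y} _ → trans (cong (g y *_) (step y)) (*-distribˡ-+ (g y) (δ y) _)) ⟩
    ∑ ys (λ y → g y * δ y + g y * length (fiber φ xs y))
      ≡⟨ ∑-distrib-+ ys (λ y → g y * δ y) _ ⟩
    ∑ ys (λ y → g y * δ y) + ∑ ys (λ y → g y * length (fiber φ xs y))
      ≡⟨ cong₂ _+_ ∑δ (sym (∑-fiber φ g xs u (φ∈ ∘ there))) ⟩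
    g (φ x) + ∑ xs (g ∘ φ) ∎)
    where
    open ≡-Reasoning
    -- The indicator of `φ x ≡ y`, written as a fibre length so that `filter-++` splits off the
    -- head.
    δ : Y → ℕ
    δ y = length (fiber φ (x ∷ []) y)
    step : ∀ y → length (fiber φ (x ∷ xs) y) ≡ δ y + length (fiber φ xs y)
    step y = trans (cong length (filter-++ (λ z → φ z ≟ y) (x ∷ []) xs)) (length-++ (fiber φ (x ∷ []) y))
    ∑δ : ∑ ys (λ y → g y * δ y) ≡ g (φ x)
    ∑δ = trans
      (∑-single _ u (φ∈ (here refl)) λ {y} y≢ →
        trans (cong (λ zs → g y * length zs) (filter-reject (λ z → φ z ≟ y) (y≢ ∘ sym))) (*-zeroʳ (g y)))
      (trans (cong (λ zs → g (φ x) * length zs) (filter-accept (λ z → φ z ≟ φ x) refl)) (*-identityʳ _))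

-- Occurrence patterns as Boolean sequences.

-- Sequences o : ℕ → Bool record at which offsets a given word occurs.

someUpTo : ℕ → (ℕ → Bool) → Bool
someUpTo zero    o = o 0
someUpTo (suc q) o = o 0 ∨ someUpTo q (o ∘ suc)

onlyFirst : ℕ → (ℕ → Bool) → Bool
onlyFirst zero    o = o 0
onlyFirst (suc q) o = o 0 ∧ not (someUpTo q (o ∘ suc))

-- The pattern of a complete return: the corresponding return word has length `suc q`, which is
-- never 0.
firstAndLast : ℕ → (ℕ → Bool) → Bool
firstAndLast q o = onlyFirst q o ∧ o (suc q)

⟦_⟧ : Bool → ℕ
⟦ b ⟧ = if b then 1 else 0

someUpTo-cong : ∀ q {o o′} → (∀ p → p ≤ q → o p ≡ o′ p) → someUpTo q o ≡ someUpTo q o′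
someUpTo-cong zero    eq = eq 0 z≤n
someUpTo-cong (suc q) eq = cong₂ _∨_ (eq 0 z≤n) (someUpTo-cong q λ p p≤q → eq (suc p) (s≤s p≤q))

someUpTo-last : ∀ q o → someUpTo (suc q) o ≡ someUpTo q o ∨ o (suc q)
someUpTo-last zero    o = refl
someUpTo-last (suc q) o = trans (cong (o 0 ∨_) (someUpTo-last q (o ∘ suc))) (sym (∨-assoc (o 0) _ _))

someUpTo⁺ : ∀ q {o p} → p ≤ q → o p ≡ true → someUpTo q o ≡ true
someUpTo⁺ zero    z≤n eq = eq
someUpTo⁺ (suc q) {o} {zero} p≤q eq rewrite eq = refl
someUpTo⁺ (suc q) {o} {suc p} (s≤s p≤q) eq with o 0
... | true  = refl
... | false = someUpTo⁺ q p≤q eq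

someUpTo-none : ∀ q {o} → (∀ p → p ≤ q → o p ≡ false) → someUpTo q o ≡ false
someUpTo-none zero    none = none 0 z≤n
someUpTo-none (suc q) none rewrite none 0 z≤n = someUpTo-none q λ p p≤q → none (suc p) (s≤s p≤q)

-- Either a positive offset carries an occurrence or 0 is the only one that does. Iterated, this
-- sorts words by their last occurrence.
someUpTo-suc : ∀ q o → ⟦ someUpTo (suc q) o ⟧ ≡ ⟦ someUpTo q (o ∘ suc) ⟧ + ⟦ onlyFirst (suc q) o ⟧
someUpTo-suc q o with o 0 | someUpTo q (o ∘ suc)
... | true  | true  = refl
... | true  | false = refl
... | false | b     = sym (+-identityʳ _)

-- Inspecting the further offset `suc q` either leaves the first occurrence alone or completes a
-- return.
onlyFirst-suc : ∀ q o → ⟦ onlyFirst q o ⟧ ≡ ⟦ onlyFirst (suc q) o ⟧ + ⟦ firstAndLast q o ⟧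
onlyFirst-suc zero o with o 0 | o 1
... | true  | true  = refl
... | true  | false = refl
... | false | _     = refl
onlyFirst-suc (suc q) o rewrite someUpTo-last q (o ∘ suc) with o 0 | someUpTo q (o ∘ suc) | o (2 + q)
... | true  | true  | _     = refl
... | true  | false | true  = refl
... | true  | false | false = refl
... | false | _     | _     = refl

firstAndLast⁺ : ∀ q {o} → o 0 ≡ true → (∀ p → p < q → o (suc p) ≡ false) → o (suc q) ≡ true →
  firstAndLast q o ≡ true
firstAndLast⁺ zero    first none last rewrite first = last
firstAndLast⁺ (suc q) {o} first none last
  rewrite first | someUpTo-none q {o ∘ suc} (λ p p≤q → none p (s≤s p≤q)) = last

firstAndLast⁻ : ∀ q {o} → firstAndLast q o ≡ true →
  o 0 ≡ true × (∀ p → p < q → o (suc p) ≢ true) × o (suc q) ≡ true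
firstAndLast⁻ zero {o} eq with o 0
... | true = refl , (λ _ ()) , eq
firstAndLast⁻ (suc q) {o} eq with o 0 | someUpTo q (o ∘ suc) in some
... | true | false = refl , (λ p p<1+q op → case-⊥ (trans (sym some) (someUpTo⁺ q (≤-pred p<1+q) op))) , eq
  where
  case-⊥ : false ≢ true
  case-⊥ ()

length-filter-T : ∀ {x} {X : Set x} (b : X → Bool) xs → length (filter (T? ∘ b) xs) ≡ ∑ xs (⟦_⟧ ∘ b)
length-filter-T b [] = refl
length-filter-T b (x ∷ xs) with b x
... | true  = cong suc (length-filter-T b xs)
... | false = length-filter-T b xs

does-true : ∀ {p} {P : Set p} (P? : Dec P) → does P? ≡ true → P
does-true (yes p) _ = p

next : ∀ {p} {P : Pred ℕ p} → Decidable P → ∀ {i j} → i < j → P j →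
  ∃[ l ] i < l × P l × (∀ m → i < m → m < l → ¬ P m)
next {P = P} P? {i} {j} i<j = go (j ∸ suc i) i (m+[n∸m]≡n i<j)
  where
  go : ∀ d i → suc i + d ≡ j → P j → ∃[ l ] i < l × P l × (∀ m → i < m → m < l → ¬ P m)
  go zero i eq Pj = suc i , ≤-refl , subst P (trans (sym eq) (+-identityʳ _)) Pj ,
    λ m i<m m<1+i _ → <⇒≱ m<1+i i<m
  go (suc d) i eq Pj with P? (suc i)
  ... | yes P1+i = suc i , ≤-refl , P1+i , λ m i<m m<1+i _ → <⇒≱ m<1+i i<m
  ... | no ¬P1+i with go d (suc i) (trans (sym (+-suc (suc i) d)) eq) Pj
  ... | l , 1+i<l , Pl , gap = l , <⇒≤ 1+i<l , Pl , gap′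
    where
    gap′ : ∀ m → i < m → m < l → ¬ P m
    gap′ m i<m m<l Pm with m≤n⇒m<n∨m≡n i<m
    ... | inj₁ 1+i<m = gap m 1+i<m m<l Pm
    ... | inj₂ refl  = ¬P1+i Pm

-- Words and factors.

module _ {a} {A : Set a} where

  take-applyUpTo : ∀ (f : ℕ → A) {m n} → m ≤ n → take m (applyUpTo f n) ≡ applyUpTo f m
  take-applyUpTo f z≤n       = refl
  take-applyUpTo f (s≤s m≤n) = cong (f 0 ∷_) (take-applyUpTo (f ∘ suc) m≤n)

  applyUpTo-cong : ∀ {f g : ℕ → A} n → (∀ i → f i ≡ g i) → applyUpTo f n ≡ applyUpTo g n
  applyUpTo-cong zero    _   = refl
  applyUpTo-cong (suc n) f≗g = cong₂ _∷_ (f≗g 0) (applyUpTo-cong n (f≗g ∘ suc))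

  drop-applyUpTo : ∀ (f : ℕ → A) p n → drop p (applyUpTo f n) ≡ applyUpTo (f ∘ (p +_)) (n ∸ p)
  drop-applyUpTo f zero    n       = refl
  drop-applyUpTo f (suc p) zero    = refl
  drop-applyUpTo f (suc p) (suc n) = drop-applyUpTo (f ∘ suc) p n

  Palindrome-extend : ∀ {w : List A} x → Palindrome w → Palindrome (x ∷ w ++ [ x ])
  Palindrome-extend {w} x pal = sym (begin
    reverse (x ∷ w ++ [ x ])     ≡⟨ unfold-reverse x (w ++ [ x ]) ⟩
    reverse (w ++ [ x ]) ++ [ x ] ≡⟨ cong (_++ [ x ]) (reverse-++ w [ x ]) ⟩
    x ∷ reverse w ++ [ x ]       ≡⟨ cong (λ v → x ∷ v ++ [ x ]) pal ⟨
    x ∷ w ++ [ x ]               ∎)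
    where open ≡-Reasoning

  take-length-++ : ∀ (xs ys : List A) → take (length xs) (xs ++ ys) ≡ xs
  take-length-++ []       ys = refl
  take-length-++ (x ∷ xs) ys = cong (x ∷_) (take-length-++ xs ys)

  drop-length-++ : ∀ (xs ys : List A) → drop (length xs) (xs ++ ys) ≡ ys
  drop-length-++ []       ys = refl
  drop-length-++ (x ∷ xs) ys = drop-length-++ xs ys

module _ {a} {A : Set a} (u : ℕ → A) where

  length-factorAt : ∀ i n → length (factorAt u i n) ≡ n
  length-factorAt i n = length-applyUpTo _ n

  factorAt-prefix : ∀ i {m n} → m ≤ n → take m (factorAt u i n) ≡ factorAt u i m
  factorAt-prefix i = take-applyUpTo _

  factorAt-drop : ∀ i p n → drop p (factorAt u i n) ≡ factorAt u (i + p) (n ∸ p)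
  factorAt-drop i p n = trans (drop-applyUpTo _ p n)
    (applyUpTo-cong (n ∸ p) (λ l → cong u (sym (+-assoc i p l))))

  factorAt-slice : ∀ i p {m n} → p + m ≤ n → take m (drop p (factorAt u i n)) ≡ factorAt u (i + p) m
  factorAt-slice i p {m} {n} p+m≤n =
    trans (cong (take m) (factorAt-drop i p n)) (factorAt-prefix (i + p) (m+n≤o⇒n≤o∸m p p+m≤n))
    where
    m+n≤o⇒n≤o∸m : ∀ p → p + m ≤ n → m ≤ n ∸ p
    m+n≤o⇒n≤o∸m p p+m≤n = subst (_≤ n ∸ p) (m+n∸m≡n p m) (∸-monoˡ-≤ p p+m≤n)

  factorAt-tail : ∀ i n → drop 1 (factorAt u i (suc n)) ≡ factorAt u (suc i) n
  factorAt-tail i n = trans (factorAt-drop i 1 (suc n)) (cong (λ l → factorAt u l n) (+-comm i 1))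

  factorAt-init : ∀ i n → take n (factorAt u i (suc n)) ≡ factorAt u i n
  factorAt-init i n = factorAt-prefix i (n≤1+n n)

  factorAt-middle : ∀ i n → take n (drop 1 (factorAt u i (2 + n))) ≡ factorAt u (suc i) n
  factorAt-middle i n = trans (cong (take n) (factorAt-tail i (suc n))) (factorAt-init (suc i) n)

  -- With factors of length `suc n` as edges from their prefix to their tail, reversal turns an edge
  -- around: this gives its new target, `factorAt-init-reverse` its new source.
  factorAt-tail-reverse : ∀ i n → drop 1 (reverse (factorAt u i (suc n))) ≡ reverse (factorAt u i n)
  factorAt-tail-reverse i n = cong (drop 1) (begin
    reverse (factorAt u i (suc n))              ≡⟨ cong reverse (applyUpTo-∷ʳ _ n) ⟨
    reverse (factorAt u i n ++ [ u (i + n) ])   ≡⟨ reverse-++ (factorAt u i n) _ ⟩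
    u (i + n) ∷ reverse (factorAt u i n)        ∎)
    where open ≡-Reasoning

  factorAt-init-reverse : ∀ i n → take n (reverse (factorAt u i (suc n))) ≡ reverse (factorAt u (suc i) n)
  factorAt-init-reverse i n = begin
    take n (reverse (factorAt u i (suc n)))
      ≡⟨ cong (λ v → take n (reverse (u (i + 0) ∷ v))) (factorAt-tail i n) ⟩
    take n (reverse (u (i + 0) ∷ t))                 ≡⟨ cong (take n) (unfold-reverse _ t) ⟩
    take n (reverse t ++ [ u (i + 0) ])              ≡⟨ cong (λ m → take m (reverse t ++ [ u (i + 0) ])) len ⟨
    take (length (reverse t)) (reverse t ++ [ u (i + 0) ]) ≡⟨ take-length-++ (reverse t) _ ⟩
    reverse t                                        ∎
    where
    open ≡-Reasoning
    t = factorAt u (suc i) n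
    len : length (reverse t) ≡ n
    len = trans (length-reverse t) (length-factorAt (suc i) n)

  Language-infix : ∀ xs ys zs → Language u (xs ++ ys ++ zs) → Language u ys
  Language-infix xs ys zs (i , occ) = i + length xs , (begin
    factorAt u (i + length xs) (length ys)
      ≡⟨ factorAt-slice i (length xs) bound ⟨
    take (length ys) (drop (length xs) (factorAt u i (length (xs ++ ys ++ zs))))
      ≡⟨ cong (take (length ys) ∘ drop (length xs)) occ ⟩
    take (length ys) (drop (length xs) (xs ++ ys ++ zs))
      ≡⟨ cong (take (length ys)) (drop-length-++ xs _) ⟩
    take (length ys) (ys ++ zs)
      ≡⟨ take-length-++ ys zs ⟩
    ys ∎)
    where
    open ≡-Reasoning
    bound : length xs + length ys ≤ length (xs ++ ys ++ zs)
    bound = subst (length xs + length ys ≤_)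
      (sym (trans (length-++ xs) (cong (length xs +_) (length-++ ys))))
      (+-monoʳ-≤ (length xs) (m≤m+n (length ys) (length zs)))

  factor : ∀ i n → FactorOfLength u n (factorAt u i n)
  factor i n = length-factorAt i n , i , cong (factorAt u i) (length-factorAt i n)

  position : ∀ {n w} → FactorOfLength u n w → ∃[ i ] factorAt u i n ≡ w
  position (refl , i , occ) = i , occ

-- Bounded gaps in uniformly recurrent words.

module _ {a} {A : Set a} (_≟ᴬ_ : DecidableEquality A) (u : ℕ → A) (ur : UniformlyRecurrent u) where

  private
    infix 4 _≟ᵂ_
    _≟ᵂ_ : DecidableEquality (List A)
    _≟ᵂ_ = ≡-dec _≟ᴬ_

  -- Recurrence is applied to the prefix of `u` ending with the occurrence at `i`. A second
  -- occurrence of that prefix, at `j > 0`, carries `w` at `j + i`.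
  later-occurrence : ∀ w i → OccursAt u w i → ∃[ j ] i < j × OccursAt u w j
  later-occurrence w i occ with proj₁ ur (factorAt u 0 m) (proj₂ (factor u 0 m))
    where m = i + length w
  ... | i′ , j , i′<j , _ , occ-j = j + i , +-monoˡ-< i (≤-<-trans z≤n i′<j) , (begin
    factorAt u (j + i) (length w)                       ≡⟨ factorAt-slice u j i ≤-refl ⟨
    take (length w) (drop i (factorAt u j m))           ≡⟨ cong (take (length w) ∘ drop i) occ-j′ ⟩
    take (length w) (drop i (factorAt u 0 m))           ≡⟨ factorAt-slice u 0 i ≤-refl ⟩
    factorAt u i (length w)                             ≡⟨ occ ⟩
    w                                                   ∎)
    where
    open ≡-Reasoning
    m = i + length w
    occ-j′ : factorAt u j m ≡ factorAt u 0 m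
    occ-j′ = trans (cong (factorAt u j) (sym (length-factorAt u 0 m))) occ-j

  -- Positions after a known occurrence `i₀` are served by the gap bound `B`, earlier ones by `i₀`
  -- itself; hence the choice `M = i₀ + B`.
  windows : ∀ w → Language u w → ∃[ M ] (∀ i → ∃[ l ] i ≤ l × l ≤ i + M × OccursAt u w l)
  windows w lw@(i₀ , occ) with proj₂ ur w lw
  ... | B , gaps = i₀ + B , window
    where
    -- Follows successive occurrences from `i₀` on. When the current one falls behind `i₀ + d`, its
    -- successor is at most `B` further.
    from : ∀ d → ∃[ l ] i₀ + d ≤ l × l ≤ i₀ + d + B × OccursAt u w l
    from zero = i₀ , ≤-reflexive (+-identityʳ i₀) ,
      ≤-trans (≤-reflexive (sym (+-identityʳ i₀))) (m≤m+n (i₀ + 0) B) , occ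
    from (suc d) with from d
    ... | l , lower , upper , occ-l with m≤n⇒m<n∨m≡n lower
    ... | inj₁ lower< = l , subst (_≤ l) (sym (+-suc i₀ d)) lower< ,
      ≤-trans upper (+-monoˡ-≤ B (+-monoʳ-≤ i₀ (n≤1+n d))) , occ-l
    ... | inj₂ refl with later-occurrence w l occ-l
    ... | j , l<j , occ-j with next (λ i → factorAt u i (length w) ≟ᵂ w) l<j occ-j
    ... | l′ , l<l′ , occ-l′ , gap = l′ , subst (_≤ l′) (sym (+-suc i₀ d)) l<l′ ,
      ≤-trans (m∸n≤o⇒m≤n+o l′ l (gaps l l′ (l<l′ , occ-l , occ-l′ , gap)))
        (+-monoˡ-≤ B (+-monoʳ-≤ i₀ (n≤1+n d))) , occ-l′
      where
      m∸n≤o⇒m≤n+o : ∀ m n {o} → m ∸ n ≤ o → m ≤ n + o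
      m∸n≤o⇒m≤n+o m n m∸n≤o = ≤-trans (m≤n+m∸n m n) (+-monoʳ-≤ n m∸n≤o)
    window : ∀ i → ∃[ l ] i ≤ l × l ≤ i + (i₀ + B) × OccursAt u w l
    window i with ≤-total i i₀
    ... | inj₁ i≤i₀ = i₀ , i≤i₀ , ≤-trans (m≤m+n i₀ B) (m≤n+m (i₀ + B) i) , occ
    ... | inj₂ i₀≤i with from (i ∸ i₀)
    ... | l , lower , upper , occ-l rewrite m+[n∸m]≡n i₀≤i =
      l , lower , ≤-trans upper (+-monoʳ-≤ i (m≤n+m B i₀)) , occ-l

  later-factor : ∀ i₀ n i → ∃[ l ] i ≤ l × factorAt u l n ≡ factorAt u i₀ n
  later-factor i₀ n i with windows (factorAt u i₀ n) (proj₂ (factor u i₀ n))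
  ... | _ , window with window i
  ... | l , i≤l , _ , occ = l , i≤l , trans (cong (factorAt u l) (sym (length-factorAt u i₀ n))) occ

  -- Factor lists for affine complexity.

  module _ (K : ℕ) (complexity : ∀ n → Complexity u n (K * n + 1))
    (extension : ∀ w → Language u w → Palindrome w → ∃ (PalindromicExtension u w)) where

    private
      fac : ℕ → ℕ → List A
      fac = factorAt u

    C : ℕ → ℕ
    C n = K * n + 1

    C-suc : ∀ n → C (suc n) ≡ K + C n
    C-suc n = trans (cong (_+ 1) (*-suc K n)) (+-assoc K (K * n) 1)

    L : ℕ → List (List A)
    L n = proj₁ (complexity n)

    L-unique : ∀ n → Unique (L n)
    L-unique n = proj₁ (proj₂ (complexity n))

    L-length : ∀ n → length (L n) ≡ C n
    L-length n = proj₁ (proj₂ (proj₂ (complexity n)))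

    Factor⇒∈L : ∀ {n w} → FactorOfLength u n w → w ∈ L n
    Factor⇒∈L {n} {w} = Equivalence.from (proj₂ (proj₂ (proj₂ (complexity n))) w)

    ∈L⇒Factor : ∀ {n w} → w ∈ L n → FactorOfLength u n w
    ∈L⇒Factor {n} {w} = Equivalence.to (proj₂ (proj₂ (proj₂ (complexity n))) w)

    factorAt∈L : ∀ i n → fac i n ∈ L n
    factorAt∈L i n = Factor⇒∈L (factor u i n)

    ∈L⇒position : ∀ {n w} → w ∈ L n → ∃[ i ] fac i n ≡ w
    ∈L⇒position w∈ = position u (∈L⇒Factor w∈)

    -- Closure of the language under reversal.

    long-palindrome : ∀ n → ∃[ w ] n ≤ length w × Language u w × Palindrome w
    long-palindrome zero = [] , z≤n , (0 , refl) , refl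
    long-palindrome (suc n) with long-palindrome n
    ... | w , n≤ , lw , pal with extension w lw pal
    ... | _ , x , refl , lxwx = _ ,
      s≤s (≤-trans n≤ (≤-trans (m≤m+n (length w) 1) (≤-reflexive (sym (length-++ w))))) ,
      lxwx , Palindrome-extend x pal

    -- A palindromic factor long enough to hold a whole window contains `w`; being its own reversal,
    -- it contains `reverse w` as well.
    Language-reverse : ∀ w → Language u w → Language u (reverse w)
    Language-reverse w lw with windows w lw
    ... | M , window with long-palindrome (M + length w)
    ... | p , long , lp@(i , occ) , pal with window i
    ... | l , i≤l , l≤i+M , occ-l = Language-infix u (reverse ys) (reverse w) (reverse xs)
      (subst (Language u) (trans pal p≡) lp)
      where
      d = l ∸ i
      xs = take d p
      ys = drop (length w) (drop d p)
      open ≡-Reasoning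
      middle : take (length w) (drop d p) ≡ w
      middle = begin
        take (length w) (drop d p)                  ≡⟨ cong (take (length w) ∘ drop d) occ ⟨
        take (length w) (drop d (fac i (length p)))
          ≡⟨ factorAt-slice u i d (≤-trans (+-monoˡ-≤ (length w) (m≤n+o⇒m∸n≤o l i l≤i+M)) long) ⟩
        fac (i + d) (length w)                      ≡⟨ cong (λ j → fac j (length w)) (m+[n∸m]≡n i≤l) ⟩
        fac l (length w)                            ≡⟨ occ-l ⟩
        w                                           ∎
      p≡ : reverse p ≡ reverse ys ++ reverse w ++ reverse xs
      p≡ = begin
        reverse p                                         ≡⟨ cong reverse (take++drop≡id d p) ⟨
        reverse (xs ++ drop d p)
          ≡⟨ cong (λ v → reverse (xs ++ v)) (take++drop≡id (length w) (drop d p)) ⟨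
        reverse (xs ++ take (length w) (drop d p) ++ ys)  ≡⟨ cong (λ v → reverse (xs ++ v ++ ys)) middle ⟩
        reverse (xs ++ w ++ ys)                           ≡⟨ reverse-++ xs (w ++ ys) ⟩
        reverse (w ++ ys) ++ reverse xs                   ≡⟨ cong (_++ reverse xs) (reverse-++ w ys) ⟩
        (reverse ys ++ reverse w) ++ reverse xs           ≡⟨ ++-assoc (reverse ys) _ _ ⟩
        reverse ys ++ reverse w ++ reverse xs             ∎

    ∈L-reverse : ∀ {n w} → w ∈ L n → reverse w ∈ L n
    ∈L-reverse {w = w} w∈ with ∈L⇒Factor w∈
    ... | refl , lw = Factor⇒∈L (length-reverse w , Language-reverse w lw)

    -- Counting palindromes and non-palindromes.

    PalindromeIn : ℕ → Pred (List A) _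
    PalindromeIn n w = w ∈ L n × Palindrome w

    private
      -- The equation makes each palindrome the centre of its extension. Distinctness and number of
      -- the extensions then follow from those of `ps`.
      extend-all : ∀ n {ps} → All (PalindromeIn n) ps →
        ∃[ qs ] All (PalindromeIn (2 + n)) qs × map (take n ∘ drop 1) qs ≡ ps
      extend-all n [] = [] , [] , refl
      extend-all n {p ∷ _} ((p∈ , pal) ∷ pals) with extend-all n pals | ∈L⇒Factor p∈
      ... | qs , qpals , eq | refl , lp with extension p lp pal
      ... | _ , x , refl , lxpx = (x ∷ p ++ [ x ]) ∷ qs ,
        ((Factor⇒∈L (cong suc (trans (length-++ p) (+-comm (length p) 1)) , lxpx) , Palindrome-extend x pal) ∷ qpals) ,
        cong₂ _∷_ (take-length-++ p [ x ]) eq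

    -- Extension injects the palindromes of length n into those of length n + 2, so the numbers for two
    -- consecutive lengths add up to at least their sum for lengths 0 and 1.
    many-palindromes : ∀ n → ∃[ ps ] ∃[ qs ] Unique ps × Unique qs ×
      All (PalindromeIn n) ps × All (PalindromeIn (suc n)) qs × length ps + length qs ≡ 1 + C 1
    many-palindromes zero = [ [] ] , L 1 , ([] ∷ []) , L-unique 1 ,
      ((factorAt∈L 0 0 , refl) ∷ []) , All.tabulate (λ w∈ → w∈ , letter w∈) , cong suc (L-length 1)
      where
      letter : ∀ {w} → w ∈ L 1 → Palindrome w
      letter w∈ with ∈L⇒position w∈
      ... | _ , refl = refl
    many-palindromes (suc n) with many-palindromes n
    ... | ps , qs , ups , uqs , pals , qals , count with extend-all n pals
    ... | rs , rals , refl = qs , rs , uqs , map⁻ ups , qals , rals ,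
      trans (+-comm (length qs) (length rs)) (trans (cong (_+ length qs) (sym (length-map _ rs))) count)

    nonPalindrome? : Decidable (λ (w : List A) → w ≢ reverse w)
    nonPalindrome? w = ¬? (w ≟ᵂ reverse w)

    N : ℕ → List (List A)
    N n = filter nonPalindrome? (L n)

    N-free : ∀ n → FreeOn _≟ᵂ_ reverse reverse-involutive (N n)
    N-free n w∈ with ∈-filter⁻ nonPalindrome? {xs = L n} w∈
    ... | w∈L , w≢ = ∈-filter⁺ nonPalindrome? (∈L-reverse w∈L) (w≢ ∘ reverse-injective) , w≢

    N-length : ∀ n {ps} → Unique ps → All (PalindromeIn n) ps → length ps + length (N n) ≤ C n
    N-length n {ps} ups pals = begin
      length ps + length (N n)   ≡⟨ length-++ ps ⟨
      length (ps ++ N n)         ≤⟨ Unique-⊆⇒length≤ _≟ᵂ_ (++⁺ ups (filter⁺ nonPalindrome? (L-unique n)) disjoint) sub ⟩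
      length (L n)               ≡⟨ L-length n ⟩
      C n                        ∎
      where
      open ≤-Reasoning
      disjoint : ∀ {w} → ¬ (w ∈ ps × w ∈ N n)
      disjoint (w∈ps , w∈N) =
        proj₂ (∈-filter⁻ nonPalindrome? {xs = L n} w∈N) (proj₂ (All.lookup pals w∈ps))
      sub : ∀ {w} → w ∈ ps ++ N n → w ∈ L n
      sub w∈ with ∈-++⁻ ps w∈
      ... | inj₁ w∈ps = proj₁ (All.lookup pals w∈ps)
      ... | inj₂ w∈N  = proj₁ (∈-filter⁻ nonPalindrome? {xs = L n} w∈N)

    -- Lengths `n` and `suc n` have together `C n + C (suc n) = K + 2 * C n` factors, of which at
    -- least `1 + C 1 = K + 2` are palindromes. Halved, the bound says that in the graph up to
    -- reversal the edges number at most the vertices minus 1.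
    N-count : ∀ n → 2 + (length (N n) + length (N (suc n))) ≤ C n + C n
    N-count n with many-palindromes n
    ... | ps , qs , ups , uqs , pals , qals , count = +-cancelˡ-≤ K _ _ (begin
      K + (2 + (p′ + q′))                 ≡⟨ shift K (p′ + q′) ⟩
      (2 + K * 1) + (p′ + q′)             ≡⟨ cong (_+ (p′ + q′)) (trans (cong suc (+-comm 1 (K * 1))) (sym count)) ⟩
      (length ps + length qs) + (p′ + q′) ≡⟨ interchange (length ps) (length qs) p′ q′ ⟩
      (length ps + p′) + (length qs + q′) ≤⟨ +-mono-≤ (N-length n ups pals) (N-length (suc n) uqs qals) ⟩
      C n + C (suc n)                     ≡⟨ cong (C n +_) (C-suc n) ⟩
      C n + (K + C n)                     ≡⟨ move (C n) K ⟩
      K + (C n + C n)                     ∎)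
      where
      open ≤-Reasoning
      p′ = length (N n)
      q′ = length (N (suc n))
      interchange : ∀ a b c d → (a + b) + (c + d) ≡ (a + c) + (b + d)
      interchange = solve-∀
      move : ∀ c k → c + (k + c) ≡ k + (c + c)
      move = solve-∀
      shift : ∀ k m → k + (2 + m) ≡ (2 + k * 1) + m
      shift = solve-∀

    -- The graph of factors up to reversal.

    IsClass : ∀ n → ℕ → ℕ → Set a
    IsClass n i l = fac l n ≡ fac i n ⊎ fac l n ≡ reverse (fac i n)

    -- Otherwise the walk along u would connect the endpoints of the edge e = fac i (suc n) without using
    -- e or reverse e, so the graph would stay connected after removing that pair of edges.
    next-class : ∀ n i j → i ≤ j → IsClass n i (suc j) → (∀ l → i < l → l < suc j → ¬ IsClass n i l) →
      fac j (suc n) ≡ reverse (fac i (suc n))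
    next-class n i j i≤j end gap with fac i (suc n) ≟ᵂ reverse (fac i (suc n))
    -- A palindromic edge is a loop: its walk is back in the class at `suc i`, which forces `j` to
    -- be `i`.
    ... | yes pal = trans (cong (λ l → fac l (suc n)) (≤-antisym j≤i i≤j)) pal
      where
      class-suc-i : IsClass n i (suc i)
      class-suc-i = inj₂ (begin
        fac (suc i) n                          ≡⟨ factorAt-tail u i n ⟨
        drop 1 (fac i (suc n))                 ≡⟨ cong (drop 1) pal ⟩
        drop 1 (reverse (fac i (suc n)))       ≡⟨ factorAt-tail-reverse u i n ⟩
        reverse (fac i n)                      ∎)
        where open ≡-Reasoning
      j≤i : j ≤ i
      j≤i = ≮⇒≥ λ i<j → gap (suc i) ≤-refl (s≤s i<j) class-suc-i
    ... | no e≢ with fac j (suc n) ≟ᵂ reverse (fac i (suc n))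
    ... | yes eq = eq
    -- Together the two bounds give `C n + C n ≤ length (N n) + length (N (suc
    -- n))`, whereas `N-count` leaves the right side short by 2.
    ... | no e′≢ = contradiction (≤-trans vertices≤edges 2edges≤) (<⇒≱ (≤-trans (n≤1+n _) (N-count n)))
      where
      e = fac i (suc n)
      N′ = filter (¬both? _≟ᵂ_ e (reverse e)) (N (suc n))

      e∈N : e ∈ N (suc n)
      e∈N = ∈-filter⁺ nonPalindrome? (factorAt∈L i (suc n)) e≢

      vertex-transversal = transversal _≟ᵂ_ reverse reverse-involutive
        (filter⁺ nonPalindrome? (L-unique n)) (N-free n)
      edge-transversal = transversal _≟ᵂ_ reverse reverse-involutive
        (filter⁺ (¬both? _≟ᵂ_ e (reverse e)) (filter⁺ nonPalindrome? (L-unique (suc n))))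
        (FreeOn-remove _≟ᵂ_ reverse reverse-involutive (N-free (suc n)))
      vs = proj₁ vertex-transversal
      es = proj₁ edge-transversal

      -- The graph is realised on the words of `L n` themselves: `flips` glue each non-palindrome to
      -- its reversal, and `steps` are the remaining edges, one from each reversal pair.
      flips = map (λ x → x , reverse x) vs
      steps = map (λ z → take n z , drop 1 z) es

      module _ (f : List A → List A) (f-edges : ∀ {x y} → (x , y) ∈ flips ++ steps → f x ≡ f y) where

        f-reverse : ∀ {x} → x ∈ L n → f (reverse x) ≡ f x
        f-reverse {x} x∈ with x ≟ᵂ reverse x
        ... | yes pal = cong f (sym pal)
        ... | no x≢ with proj₂ (proj₂ vertex-transversal) (∈-filter⁺ nonPalindrome? x∈ x≢)
        ... | inj₁ x∈vs  = sym (f-edges (∈-++⁺ˡ (∈-map⁺ _ x∈vs)))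
        ... | inj₂ rx∈vs = trans (f-edges (∈-++⁺ˡ (∈-map⁺ _ rx∈vs))) (cong f (reverse-involutive x))

        f-suc : ∀ l → fac l (suc n) ≢ e → fac l (suc n) ≢ reverse e → f (fac l n) ≡ f (fac (suc l) n)
        f-suc l ≢e ≢re with fac l (suc n) ≟ᵂ reverse (fac l (suc n))
        -- A palindromic edge joins a word to its own reversal, and `f-reverse` already identifies
        -- these labels.
        ... | yes pal = trans (sym (f-reverse (factorAt∈L l n))) (cong f (begin
          reverse (fac l n)                     ≡⟨ factorAt-tail-reverse u l n ⟨
          drop 1 (reverse (fac l (suc n)))      ≡⟨ cong (drop 1) pal ⟨
          drop 1 (fac l (suc n))                ≡⟨ factorAt-tail u l n ⟩
          fac (suc l) n                         ∎))
          where open ≡-Reasoning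
        ... | no z≢ with proj₂ (proj₂ edge-transversal)
          (∈-filter⁺ (¬both? _≟ᵂ_ e (reverse e)) (∈-filter⁺ nonPalindrome? (factorAt∈L l (suc n)) z≢) (≢e , ≢re))
        ... | inj₁ z∈es = subst₂ (λ x y → f x ≡ f y) (factorAt-init u l n) (factorAt-tail u l n)
          (f-edges (∈-++⁺ʳ flips (∈-map⁺ _ z∈es)))
        ... | inj₂ rz∈es = trans (sym (f-reverse (factorAt∈L l n)))
          (trans (sym (subst₂ (λ x y → f x ≡ f y) (factorAt-init-reverse u l n) (factorAt-tail-reverse u l n)
            (f-edges (∈-++⁺ʳ flips (∈-map⁺ _ rz∈es))))) (f-reverse (factorAt∈L (suc l) n)))

        -- The detour from `suc i` to `suc j` avoids the removed pair: `e` starts in the class and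
        -- `reverse e` ends in it, so either would cause a visit excluded by `gap`, or at the last
        -- step contradict `e′≢`.
        f-from-i : ∀ d → i + d ≤ j → f (fac (suc i) n) ≡ f (fac (suc (i + d)) n)
        f-from-i zero    _ = cong (λ l → f (fac (suc l) n)) (sym (+-identityʳ i))
        f-from-i (suc d) i+1+d≤j = trans (f-from-i d (<⇒≤ l≤j))
          (trans (f-suc l ≢e ≢re) (cong (λ m → f (fac (suc m) n)) (sym (+-suc i d))))
          where
          l = suc (i + d)
          l≤j : l ≤ j
          l≤j = subst (_≤ j) (+-suc i d) i+1+d≤j
          i<l : i < l
          i<l = s≤s (m≤m+n i d)
          ≢e : fac l (suc n) ≢ e
          ≢e eq = gap l i<l (s≤s l≤j)
            (inj₁ (trans (sym (factorAt-init u l n)) (trans (cong (take n) eq) (factorAt-init u i n))))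
          ≢re : fac l (suc n) ≢ reverse e
          ≢re eq with m≤n⇒m<n∨m≡n l≤j
          ... | inj₂ refl = e′≢ eq
          ... | inj₁ l<j  = gap (suc l) (<-trans i<l ≤-refl) (s≤s l<j)
            (inj₂ (trans (sym (factorAt-tail u l n)) (trans (cong (drop 1) eq) (factorAt-tail-reverse u i n))))

        -- The detour ends in the class of `fac i n`, so the endpoints of the removed edge share a
        -- label after all.
        f-i : f (fac i n) ≡ f (fac (suc i) n)
        f-i = sym (trans (f-from-i (j ∸ i) (≤-reflexive i+[j∸i]≡j))
          (trans (cong (λ l → f (fac (suc l) n)) i+[j∸i]≡j) (f-end end)))
          where
          i+[j∸i]≡j = m+[n∸m]≡n i≤j
          f-end : IsClass n i (suc j) → f (fac (suc j) n) ≡ f (fac i n)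
          f-end (inj₁ eq) = cong f eq
          f-end (inj₂ eq) = trans (cong f eq) (f-reverse (factorAt∈L i n))

        f-step : ∀ l → f (fac l n) ≡ f (fac (suc l) n)
        f-step l with fac l (suc n) ≟ᵂ e | fac l (suc n) ≟ᵂ reverse e
        ... | no ≢e  | no ≢re = f-suc l ≢e ≢re
        ... | yes eq | _ = subst₂ (λ x y → f x ≡ f y)
          (trans (sym (factorAt-init u i n)) (trans (cong (take n) (sym eq)) (factorAt-init u l n)))
          (trans (sym (factorAt-tail u i n)) (trans (cong (drop 1) (sym eq)) (factorAt-tail u l n)))
          f-i
        ... | no _   | yes eq = begin
          f (fac l n)
            ≡⟨ cong f (trans (sym (factorAt-init u l n)) (trans (cong (take n) eq) (factorAt-init-reverse u i n))) ⟩
          f (reverse (fac (suc i) n)) ≡⟨ f-reverse (factorAt∈L (suc i) n) ⟩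
          f (fac (suc i) n)           ≡⟨ f-i ⟨
          f (fac i n)                 ≡⟨ f-reverse (factorAt∈L i n) ⟨
          f (reverse (fac i n))
            ≡⟨ cong f (trans (sym (factorAt-tail-reverse u i n)) (trans (cong (drop 1) (sym eq)) (factorAt-tail u l n))) ⟩
          f (fac (suc l) n)           ∎
          where open ≡-Reasoning

        f-0 : ∀ l → f (fac l n) ≡ f (fac 0 n)
        f-0 zero    = refl
        f-0 (suc l) = trans (sym (f-step l)) (f-0 l)

        f-const : ∀ {x y} → x ∈ L n → y ∈ L n → f x ≡ f y
        f-const x∈ y∈ with ∈L⇒position x∈ | ∈L⇒position y∈
        ... | l , refl | m , refl = trans (f-0 l) (sym (f-0 m))

      C≤ : C n ≤ suc (length vs + length es)
      C≤ = begin
        C n                             ≡⟨ L-length n ⟨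
        length (L n)                    ≤⟨ connected⇒length≤ _≟ᵂ_ (flips ++ steps) (L-unique n) f-const ⟩
        suc (length (flips ++ steps))
          ≡⟨ cong suc (trans (length-++ flips) (cong₂ _+_ (length-map _ vs) (length-map _ es))) ⟩
        suc (length vs + length es)     ∎
        where open ≤-Reasoning

      -- The count is doubled so that no number of non-palindromes has to be halved.
      vertices≤edges : C n + C n ≤ 2 * length vs + (2 + 2 * length es)
      vertices≤edges = ≤-trans (+-mono-≤ C≤ C≤) (≤-reflexive (double (length vs) (length es)))
        where
        double : ∀ a b → suc (a + b) + suc (a + b) ≡ 2 * a + (2 + 2 * b)
        double = solve-∀

      -- The summand 2 pays for the pair `e`, `reverse e` removed from `N (suc n)`.
      2edges≤ : 2 * length vs + (2 + 2 * length es) ≤ length (N n) + length (N (suc n))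
      2edges≤ = +-mono-≤ (proj₁ (proj₂ vertex-transversal))
        (≤-trans (+-monoʳ-≤ 2 (proj₁ (proj₂ edge-transversal)))
          (length-remove₂ _≟ᵂ_ (filter⁺ nonPalindrome? (L-unique (suc n))) e∈N (proj₁ (N-free (suc n) e∈N)) e≢))

    -- Extension graphs of factors and their neutrality.

    middle : ℕ → List A → List A
    middle n = take n ∘ drop 1

    -- Extensions are kept as whole words, in fibres of the tail, prefix and middle maps, so that
    -- `∑-fiber` can sum them over all `s`.
    lefts rights bothSides : ℕ → List A → List (List A)
    lefts     n = fiber _≟ᵂ_ (drop 1) (L (suc n))
    rights    n = fiber _≟ᵂ_ (take n) (L (suc n))
    bothSides n = fiber _≟ᵂ_ (middle n) (L (2 + n))

    private
      -- Vertices of the extension graph of s: the words xs (left side) and sy (right side); edges: the words xsy.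
      _≟ⱽ_ : DecidableEquality (List A ⊎ List A)
      _≟ⱽ_ = Sum.≡-dec _≟ᵂ_ _≟ᵂ_

      module ExtensionGraph (n s₀ : ℕ)
        (f : List A ⊎ List A → List A ⊎ List A)
        (f-edge : ∀ {v} → v ∈ bothSides n (fac s₀ n) → f (inj₁ (take (suc n) v)) ≡ f (inj₂ (drop 1 v))) where

        s : List A
        s = fac s₀ n

        f-factor : ∀ l → fac (suc l) n ≡ s → f (inj₁ (fac l (suc n))) ≡ f (inj₂ (fac (suc l) (suc n)))
        f-factor l eq = subst₂ (λ x y → f (inj₁ x) ≡ f (inj₂ y))
          (factorAt-init u l (suc n)) (factorAt-tail u l (suc n))
          (f-edge (∈-filter⁺ (λ v → middle n v ≟ᵂ s) (factorAt∈L l (2 + n)) (trans (factorAt-middle u l n) eq)))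

        -- An occurrence of `reverse s` read backwards yields a two-sided extension of `s`, by
        -- closure under reversal.
        f-factorʳ : ∀ l → fac (suc l) n ≡ reverse s →
          f (inj₁ (reverse (fac (suc l) (suc n)))) ≡ f (inj₂ (reverse (fac l (suc n))))
        f-factorʳ l eq = subst₂ (λ x y → f (inj₁ x) ≡ f (inj₂ y))
          (factorAt-init-reverse u l (suc n)) (factorAt-tail-reverse u l (suc n))
          (f-edge (∈-filter⁺ (λ v → middle n v ≟ᵂ s) (∈L-reverse (factorAt∈L l (2 + n))) (begin
            middle n (reverse (fac l (2 + n)))      ≡⟨ cong (take n) (factorAt-tail-reverse u l (suc n)) ⟩
            take n (reverse (fac l (suc n)))        ≡⟨ factorAt-init-reverse u l n ⟩
            reverse (fac (suc l) n)                 ≡⟨ cong reverse eq ⟩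
            reverse (reverse s)                     ≡⟨ reverse-involutive s ⟩
            s                                       ∎)))
          where open ≡-Reasoning

        Class : ℕ → Set a
        Class l = fac l n ≡ s ⊎ fac l n ≡ reverse s

        Class? : Decidable Class
        Class? l = (fac l n ≟ᵂ s) ⊎-dec (fac l n ≟ᵂ reverse s)

        Class-shift : ∀ {i l} → Class i → fac l n ≡ fac i n ⊎ fac l n ≡ reverse (fac i n) → Class l
        Class-shift (inj₁ p) (inj₁ q) = inj₁ (trans q p)
        Class-shift (inj₂ p) (inj₁ q) = inj₂ (trans q p)
        Class-shift (inj₁ p) (inj₂ q) = inj₂ (trans q (cong reverse p))
        Class-shift (inj₂ p) (inj₂ q) = inj₁ (trans q (trans (cong reverse p) (reverse-involutive s)))

        Class-unshift : ∀ {i l} → Class i → Class l → fac l n ≡ fac i n ⊎ fac l n ≡ reverse (fac i n)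
        Class-unshift (inj₁ p) (inj₁ q) = inj₁ (trans q (sym p))
        Class-unshift (inj₂ p) (inj₂ q) = inj₁ (trans q (sym p))
        Class-unshift (inj₁ p) (inj₂ q) = inj₂ (trans q (cong reverse (sym p)))
        Class-unshift (inj₂ p) (inj₁ q) = inj₂ (trans q (trans (sym (reverse-involutive s)) (cong reverse (sym p))))

        module _ (c : List A ⊎ List A) where

          -- The edge of the walk ending (In) or starting (Out) at an occurrence of s or reverse s has label c; an
          -- occurrence of reverse s is read backwards, which exchanges the two sides.
          In Out : ℕ → Set a
          In l  = (fac (suc l) n ≡ s → f (inj₁ (fac l (suc n))) ≡ c)
                × (fac (suc l) n ≡ reverse s → f (inj₂ (reverse (fac l (suc n)))) ≡ c)
          Out l = (fac l n ≡ s → f (inj₂ (fac l (suc n))) ≡ c)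
                × (fac l n ≡ reverse s → f (inj₁ (reverse (fac l (suc n)))) ≡ c)

          -- Crossing an occurrence traverses one edge of the extension graph.
          In⇒Out : ∀ l → In l → Out (suc l)
          In⇒Out l (p , q) =
            (λ eq → trans (sym (f-factor l eq)) (p eq)) , (λ eq → trans (f-factorʳ l eq) (q eq))

          -- Between consecutive occurrences the mirror relation of `next-class` reverses the
          -- reading direction, so the vertex left behind and the vertex reached are the same.
          Out⇒In : ∀ i j → fac j (suc n) ≡ reverse (fac i (suc n)) → Out i → In j
          Out⇒In i j eq (p , q) =
            (λ eq′ → trans (cong (f ∘ inj₁) eq)
              (q (trans (sym (reverse-involutive _)) (cong reverse (trans (sym mirror) eq′))))) ,
            (λ eq′ → trans (cong (f ∘ inj₂) (trans (cong reverse eq) (reverse-involutive _)))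
              (p (reverse-injective (trans (sym mirror) eq′))))
            where
            mirror : fac (suc j) n ≡ reverse (fac i n)
            mirror = trans (sym (factorAt-tail u j n)) (trans (cong (drop 1) eq) (factorAt-tail-reverse u i n))

          module _ (i₀ : ℕ) (class-i₀ : Class (suc i₀)) (in-i₀ : In i₀) where

            -- The induction carries the latest occurrence at or before `suc (i₀ + d)`; its last
            -- component supplies the gap hypothesis of `next-class`. Occurrences sit at `suc l`
            -- because `In l` reads the preceding letter.
            last-class : ∀ d → ∃[ l ] l ≤ i₀ + d × Class (suc l) × In l ×
              (∀ m → l < m → m ≤ i₀ + d → ¬ Class (suc m))
            last-class zero = i₀ , m≤m+n i₀ 0 , class-i₀ , in-i₀ ,
              λ m i₀<m m≤i₀ _ → <⇒≱ i₀<m (subst (m ≤_) (+-identityʳ i₀) m≤i₀)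
            last-class (suc d) rewrite +-suc i₀ d with last-class d
            ... | l , l≤ , class-l , in-l , gap with Class? (2 + (i₀ + d))
            ... | no ¬class = l , m≤n⇒m≤1+n l≤ , class-l , in-l , gap′
              where
              gap′ : ∀ m → l < m → m ≤ suc (i₀ + d) → ¬ Class (suc m)
              gap′ m l<m m≤ with m≤n⇒m<n∨m≡n m≤
              ... | inj₁ m<   = gap m l<m (≤-pred m<)
              ... | inj₂ refl = ¬class
            ... | yes class = suc (i₀ + d) , ≤-refl , class ,
              Out⇒In (suc l) (suc (i₀ + d))
                (next-class n (suc l) (suc (i₀ + d)) (s≤s l≤) (Class-unshift class-l class) gap′)
                (In⇒Out l in-l) ,
              λ m m> m≤ _ → <⇒≱ m> m≤
              where
              gap′ : ∀ m → suc l < m → m < 2 + (i₀ + d) →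
                ¬ (fac m n ≡ fac (suc l) n ⊎ fac m n ≡ reverse (fac (suc l) n))
              gap′ (suc m) l<m m< = gap m (≤-pred l<m) (≤-pred (≤-pred m<)) ∘ Class-shift class-l

            all-In : ∀ m → i₀ ≤ m → Class (suc m) → In m
            all-In m i₀≤m class with last-class (m ∸ i₀)
            ... | l , l≤ , _ , in-l , gap rewrite m+[n∸m]≡n i₀≤m with m≤n⇒m<n∨m≡n l≤
            ... | inj₁ l<m  = contradiction class (gap m l<m ≤-refl)
            ... | inj₂ refl = in-l

            -- By recurrence each left extension appears again beyond `i₀`, where `all-In`
            -- determines its label.
            left-const : ∀ {v} → v ∈ lefts n s → f (inj₁ v) ≡ c
            left-const v∈ with ∈-filter⁻ (λ v → drop 1 v ≟ᵂ s) {xs = L (suc n)} v∈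
            ... | v∈L , v≡ with ∈L⇒position v∈L
            ... | m , refl with later-factor m (suc n) i₀
            ... | l , i₀≤l , eq = trans (cong (f ∘ inj₁) (sym eq)) (proj₁ (all-In l i₀≤l (inj₁ occ)) occ)
              where
              occ : fac (suc l) n ≡ s
              occ = trans (sym (factorAt-tail u l n)) (trans (cong (drop 1) eq) v≡)

            right-const : ∀ {v} → v ∈ rights n s → f (inj₂ v) ≡ c
            right-const v∈ with ∈-filter⁻ (λ v → take n v ≟ᵂ s) {xs = L (suc n)} v∈
            ... | v∈L , v≡ with ∈L⇒position v∈L
            ... | m , refl with later-factor m (suc n) (suc i₀)
            ... | suc l , s≤s i₀≤l , eq =
              trans (cong (f ∘ inj₂) (sym eq)) (proj₁ (In⇒Out l (all-In l i₀≤l (inj₁ occ))) occ)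
              where
              occ : fac (suc l) n ≡ s
              occ = trans (sym (factorAt-init u (suc l) n)) (trans (cong (take n) eq) v≡)

        -- For a palindrome `s` both halves of `In` apply at once. They agree inside a palindromic
        -- extension of `s`, whose edge joins a left vertex to its mirror image on the right. For
        -- other `s` one half is vacuous.
        start : ∃[ c ] ∃[ i₀ ] Class (suc i₀) × In c i₀
        start with s ≟ᵂ reverse s
        ... | no s≢ with later-factor s₀ n 1
        ... | suc i₀ , _ , occ = f (inj₁ (fac i₀ (suc n))) , i₀ , inj₁ occ ,
          (λ _ → refl) , λ eq → contradiction (trans (sym occ) eq) s≢
        start | yes pal with extension s (proj₂ (factor u s₀ n)) pal
        ... | _ , x , refl , lv with ∈L⇒position (Factor⇒∈L (len , lv))
          where
          len : length (x ∷ s ++ [ x ]) ≡ 2 + n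
          len = cong suc (trans (length-++ s) (trans (+-comm (length s) 1) (cong suc (length-factorAt u s₀ n))))
        ... | i₀ , eq = f (inj₁ (fac i₀ (suc n))) , i₀ , inj₁ occ ,
          (λ _ → refl) , λ _ → trans (cong (f ∘ inj₂) mirror) (sym (f-factor i₀ occ))
          where
          open ≡-Reasoning
          occ : fac (suc i₀) n ≡ s
          occ = begin
            fac (suc i₀) n                           ≡⟨ factorAt-middle u i₀ n ⟨
            middle n (fac i₀ (2 + n))                ≡⟨ cong (middle n) eq ⟩
            take n (s ++ [ x ])                      ≡⟨ cong (λ m → take m (s ++ [ x ])) (length-factorAt u s₀ n) ⟨
            take (length s) (s ++ [ x ])             ≡⟨ take-length-++ s [ x ] ⟩
            s                                        ∎
          mirror : reverse (fac i₀ (suc n)) ≡ fac (suc i₀) (suc n)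
          mirror = begin
            reverse (fac i₀ (suc n))                 ≡⟨ factorAt-tail-reverse u i₀ (suc n) ⟨
            drop 1 (reverse (fac i₀ (2 + n)))        ≡⟨ cong (drop 1 ∘ reverse) eq ⟩
            drop 1 (reverse (x ∷ s ++ [ x ]))        ≡⟨ cong (drop 1) (Palindrome-extend x pal) ⟨
            drop 1 (x ∷ s ++ [ x ])                  ≡⟨ cong (drop 1) eq ⟨
            drop 1 (fac i₀ (2 + n))                  ≡⟨ factorAt-tail u i₀ (suc n) ⟩
            fac (suc i₀) (suc n)                     ∎

    -- The extension graph of `s` is connected, so its vertices exceed its edges by at most 1.
    not-weak : ∀ n {s} → s ∈ L n →
      length (lefts n s) + length (rights n s) ≤ 1 + length (bothSides n s)
    not-weak n s∈ with ∈L⇒position s∈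
    ... | s₀ , refl = begin
      length (lefts n s) + length (rights n s)
        ≡⟨ cong₂ _+_ (length-map inj₁ (lefts n s)) (length-map inj₂ (rights n s)) ⟨
      length ls + length rs                     ≡⟨ length-++ ls ⟨
      length (ls ++ rs)                         ≤⟨ connected⇒length≤ _≟ⱽ_ edges unique connected ⟩
      1 + length edges                          ≡⟨ cong suc (length-map _ (bothSides n s)) ⟩
      1 + length (bothSides n s)                ∎
      where
      open ≤-Reasoning
      s = fac s₀ n
      ls rs : List (List A ⊎ List A)
      ls = map inj₁ (lefts n s)
      rs = map inj₂ (rights n s)
      edges : List ((List A ⊎ List A) × (List A ⊎ List A))
      edges = map (λ v → inj₁ (take (suc n) v) , inj₂ (drop 1 v)) (bothSides n s)
      disjoint : ∀ {x} → ¬ (x ∈ ls × x ∈ rs)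
      disjoint (x∈ls , x∈rs) with ∈-map⁻ inj₁ x∈ls | ∈-map⁻ inj₂ x∈rs
      ... | _ , _ , refl | _ , _ , ()
      unique : Unique (ls ++ rs)
      unique = ++⁺
        (map⁺ Sum.inj₁-injective (filter⁺ (λ v → drop 1 v ≟ᵂ s) (L-unique (suc n))))
        (map⁺ Sum.inj₂-injective (filter⁺ (λ v → take n v ≟ᵂ s) (L-unique (suc n)))) disjoint
      connected : Connected _≟ⱽ_ (ls ++ rs) edges
      connected f f-edges x∈ y∈ = trans (const x∈) (sym (const y∈))
        where
        module G = ExtensionGraph n s₀ f (λ v∈ → f-edges (∈-map⁺ _ v∈))
        const : ∀ {x} → x ∈ ls ++ rs → f x ≡ proj₁ G.start
        const x∈ with ∈-++⁻ ls x∈ | G.start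
        ... | inj₁ x∈ls | c , i₀ , class , in-i₀ with ∈-map⁻ inj₁ x∈ls
        ... | _ , v∈ , refl = G.left-const c i₀ class in-i₀ v∈
        const x∈ | inj₂ x∈rs | c , i₀ , class , in-i₀ with ∈-map⁻ inj₂ x∈rs
        ... | _ , v∈ , refl = G.right-const c i₀ class in-i₀ v∈

    middle∈ : ∀ {n v} → v ∈ L (2 + n) → middle n v ∈ L n
    middle∈ {n} v∈ with ∈L⇒position v∈
    ... | i , refl = subst (_∈ L n) (sym (factorAt-middle u i n)) (factorAt∈L (suc i) n)
    tail∈ : ∀ {n v} → v ∈ L (suc n) → drop 1 v ∈ L n
    tail∈ {n} v∈ with ∈L⇒position v∈
    ... | i , refl = subst (_∈ L n) (sym (factorAt-tail u i n)) (factorAt∈L (suc i) n)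
    init∈ : ∀ {n v} → v ∈ L (suc n) → take n v ∈ L n
    init∈ {n} v∈ with ∈L⇒position v∈
    ... | i , refl = subst (_∈ L n) (sym (factorAt-init u i n)) (factorAt∈L i n)

    -- Summed over `s`, the two sides of `not-weak` become `C (suc n) + C (suc n)` and
    -- `C n + C (2 + n)`, which are equal because `C` is affine.
    neutral : ∀ n {s} → s ∈ L n →
      length (lefts n s) + length (rights n s) ≡ 1 + length (bothSides n s)
    neutral n = ∑-tight (L n) (not-weak n) (≤-reflexive (begin
      ∑ (L n) (λ s → 1 + length (bothSides n s))
        ≡⟨ ∑-distrib-+ (L n) (λ _ → 1) _ ⟩
      ∑ (L n) (λ _ → 1) + ∑ (L n) (length ∘ bothSides n)
        ≡⟨ cong₂ _+_ (trans (∑-one (L n)) (L-length n)) (count (2 + n) (middle n) middle∈) ⟩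
      C n + C (2 + n)
        ≡⟨ arith ⟩
      C (suc n) + C (suc n)
        ≡⟨ cong₂ _+_ (count (suc n) (drop 1) tail∈)
                     (count (suc n) (take n) init∈) ⟨
      ∑ (L n) (length ∘ lefts n) + ∑ (L n) (length ∘ rights n)
        ≡⟨ ∑-distrib-+ (L n) (length ∘ lefts n) (length ∘ rights n) ⟨
      ∑ (L n) (λ s → length (lefts n s) + length (rights n s)) ∎))
      where
      open ≡-Reasoning
      arith : C n + C (2 + n) ≡ C (suc n) + C (suc n)
      arith rewrite C-suc (suc n) | C-suc n = solve′ (C n) K
        where
        solve′ : ∀ c k → c + (k + (k + c)) ≡ (k + c) + (k + c)
        solve′ = solve-∀
      count : ∀ m φ → (∀ {w} → w ∈ L m → φ w ∈ L n) → ∑ (L n) (λ s → length (fiber _≟ᵂ_ φ (L m) s)) ≡ C m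
      count m φ φ∈ = begin
        ∑ (L n) (λ s → length (fiber _≟ᵂ_ φ (L m) s))
          ≡⟨ ∑-cong (L n) (λ _ → sym (*-identityˡ _)) ⟩
        ∑ (L n) (λ s → 1 * length (fiber _≟ᵂ_ φ (L m) s))
          ≡⟨ ∑-fiber _≟ᵂ_ φ (λ _ → 1) (L m) (L-unique n) φ∈ ⟨
        ∑ (L m) (λ _ → 1)
          ≡⟨ trans (∑-one (L m)) (L-length m) ⟩
        C m ∎

    -- The identity `neutral` weighted by `g s`, with fibres turned back into sums over words. It is
    -- applied to indicators of containing a given word.
    ∑-neutral : ∀ n (g : List A → ℕ) →
      ∑ (L (2 + n)) (g ∘ middle n) + ∑ (L n) g ≡ ∑ (L (suc n)) (g ∘ drop 1) + ∑ (L (suc n)) (g ∘ take n)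
    ∑-neutral n g = begin
      ∑ (L (2 + n)) (g ∘ middle n) + ∑ (L n) g
        ≡⟨ cong (_+ ∑ (L n) g) (∑-fiber _≟ᵂ_ (middle n) g (L (2 + n)) (L-unique n) middle∈) ⟩
      ∑ (L n) (λ s → g s * length (bothSides n s)) + ∑ (L n) g
        ≡⟨ ∑-distrib-+ (L n) _ g ⟨
      ∑ (L n) (λ s → g s * length (bothSides n s) + g s)
        ≡⟨ ∑-cong (L n) pointwise ⟩
      ∑ (L n) (λ s → g s * length (lefts n s) + g s * length (rights n s))
        ≡⟨ ∑-distrib-+ (L n) (λ s → g s * length (lefts n s)) _ ⟩
      ∑ (L n) (λ s → g s * length (lefts n s)) + ∑ (L n) (λ s → g s * length (rights n s))
        ≡⟨ cong₂ _+_ (∑-fiber _≟ᵂ_ (drop 1) g (L (suc n)) (L-unique n) tail∈)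
                     (∑-fiber _≟ᵂ_ (take n) g (L (suc n)) (L-unique n) init∈) ⟨
      ∑ (L (suc n)) (g ∘ drop 1) + ∑ (L (suc n)) (g ∘ take n) ∎
      where
      open ≡-Reasoning
      pointwise : ∀ {s} → s ∈ L n →
        g s * length (bothSides n s) + g s ≡ g s * length (lefts n s) + g s * length (rights n s)
      pointwise {s} s∈ = trans (+-comm _ (g s)) (trans (sym (*-suc (g s) _))
        (trans (cong (g s *_) (sym (neutral n s∈))) (*-distribˡ-+ (g s) _ _)))

    -- Counting return words through the growth of the complexity.

    module _ (w : List A) (w∈ : Language u w) where

      private
        n = length w

      offsets : List A → ℕ → Bool
      offsets v p = does (take n (drop p v) ≟ᵂ w)

      offsets-factor : ∀ i {m} p → p + n ≤ m → offsets (fac i m) p ≡ does (fac (i + p) n ≟ᵂ w)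
      offsets-factor i p p+n≤m = cong (λ v → does (v ≟ᵂ w)) (factorAt-slice u i p p+n≤m)

      offsets-tail : ∀ v p → offsets (drop 1 v) p ≡ offsets v (suc p)
      offsets-tail v p = cong (λ x → does (take n x ≟ᵂ w)) (drop-drop 1 p v)

      some only return : ℕ → List A → ℕ
      some   q v = ⟦ someUpTo q (offsets v) ⟧
      only   q v = ⟦ onlyFirst q (offsets v) ⟧
      return q v = ⟦ firstAndLast q (offsets v) ⟧

      some-init : ∀ q {v} → v ∈ L (suc q + n) → some q (take (q + n) v) ≡ some q v
      some-init q v∈ with ∈L⇒position v∈
      ... | i , refl = cong ⟦_⟧ (someUpTo-cong q λ p p≤q → begin
        offsets (take (q + n) (fac i (suc q + n))) p   ≡⟨ cong (λ v → offsets v p) (factorAt-init u i (q + n)) ⟩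
        offsets (fac i (q + n)) p                      ≡⟨ offsets-factor i p (+-monoˡ-≤ n p≤q) ⟩
        does (fac (i + p) n ≟ᵂ w)                      ≡⟨ offsets-factor i p (m≤n⇒m≤1+n (+-monoˡ-≤ n p≤q)) ⟨
        offsets (fac i (suc q + n)) p                  ∎)
        where open ≡-Reasoning

      some-middle : ∀ q {v} → v ∈ L (2 + q + n) → some q (middle (q + n) v) ≡ some q (drop 1 v)
      some-middle q v∈ = some-init q (tail∈ v∈)

      some-suc : ∀ q m → ∑ (L m) (some (suc q)) ≡ ∑ (L m) (some q ∘ drop 1) + ∑ (L m) (only (suc q))
      some-suc q m = trans
        (∑-cong (L m) λ {v} _ → trans (someUpTo-suc q (offsets v))
          (cong (λ b → ⟦ b ⟧ + only (suc q) v) (sym (someUpTo-cong q λ p _ → offsets-tail v p))))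
        (∑-distrib-+ (L m) _ (only (suc q)))

      only-suc : ∀ q m → ∑ (L m) (only q) ≡ ∑ (L m) (only (suc q)) + ∑ (L m) (return q)
      only-suc q m = trans (∑-cong (L m) λ {v} _ → onlyFirst-suc q (offsets v)) (∑-distrib-+ (L m) (only (suc q)) _)

      some-zero : ∑ (L n) (some 0) ≡ 1
      some-zero = begin
        ∑ (L n) (some 0)                       ≡⟨ ∑-cong (L n) whole ⟩
        ∑ (L n) (λ v → ⟦ does (v ≟ᵂ w) ⟧)
          ≡⟨ ∑-single _ (L-unique n) (Factor⇒∈L (refl , w∈)) (λ v≢w → cong ⟦_⟧ (dec-false (_ ≟ᵂ w) v≢w)) ⟩
        ⟦ does (w ≟ᵂ w) ⟧                      ≡⟨ cong ⟦_⟧ (dec-true (w ≟ᵂ w) refl) ⟩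
        1                                      ∎
        where
        open ≡-Reasoning
        whole : ∀ {v} → v ∈ L n → some 0 v ≡ ⟦ does (v ≟ᵂ w) ⟧
        whole {v} v∈ = cong (λ x → ⟦ does (x ≟ᵂ w) ⟧) (take-all n v (≤-reflexive (proj₁ (∈L⇒Factor v∈))))

      -- The number of return words of length at most `q`; one of length `suc q` is counted through
      -- its complete return, of length `suc q + n`.
      returnsUpTo : ℕ → ℕ
      returnsUpTo zero    = 0
      returnsUpTo (suc q) = returnsUpTo q + ∑ (L (suc q + n)) (return q)

      -- The difference of the two `some q` sums is the total right branching of the words of length
      -- `q + n` containing `w`. From `q` to `suc q`, `some-suc` splits off the words with `w` only
      -- in front, `∑-neutral` moves the branching of the others to shorter words, and `only-suc`
      -- separates the completed returns.
      some-count : ∀ q → ∑ (L (suc q + n)) (some q) + 1 ≡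
        ∑ (L (q + n)) (some q) + (returnsUpTo (suc q) + ∑ (L (suc q + n)) (only (suc q)))
      some-count zero = begin
        ∑ (L (suc n)) (only 0) + 1   ≡⟨ +-comm _ 1 ⟩
        1 + ∑ (L (suc n)) (only 0)
          ≡⟨ cong₂ _+_ (sym some-zero) (trans (only-suc 0 (suc n)) (+-comm (∑ (L (suc n)) (only 1)) _)) ⟩
        ∑ (L n) (some 0) + (∑ (L (suc n)) (return 0) + ∑ (L (suc n)) (only 1)) ∎
        where open ≡-Reasoning
      -- Adding `Y` stands in for the subtraction in the difference of sums.
      some-count (suc q) = +-cancelˡ-≡ Y _ _ (begin
        Y + (∑ (L (2 + q + n)) (some (suc q)) + 1)
          ≡⟨ cong (λ x → Y + (x + 1)) (trans (some-suc q (2 + q + n)) (cong (X +_) (only-suc (suc q) (2 + q + n)))) ⟩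
        Y + ((X + (F′ + R′)) + 1)
          ≡⟨ arith₁ Y X F′ R′ ⟩
        (X + Y) + (F′ + R′ + 1)
          ≡⟨ cong (_+ (F′ + R′ + 1)) neutrality ⟩
        (Z + W) + (F′ + R′ + 1)
          ≡⟨ arith₂ Z W F′ R′ ⟩
        (W + 1) + (Z + F′ + R′)
          ≡⟨ cong (_+ (Z + F′ + R′)) (some-count q) ⟩
        (Y + (R + F)) + (Z + F′ + R′)
          ≡⟨ arith₃ Y R F Z F′ R′ ⟩
        Y + ((Z + F) + ((R + R′) + F′))
          ≡⟨ cong (λ x → Y + (x + ((R + R′) + F′))) (some-suc q (suc q + n)) ⟨
        Y + (∑ (L (suc q + n)) (some (suc q)) + ((R + R′) + F′)) ∎)
        where
        open ≡-Reasoning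
        X = ∑ (L (2 + q + n)) (some q ∘ drop 1)
        Y = ∑ (L (q + n)) (some q)
        Z = ∑ (L (suc q + n)) (some q ∘ drop 1)
        W = ∑ (L (suc q + n)) (some q)
        R = returnsUpTo (suc q)
        R′ = ∑ (L (2 + q + n)) (return (suc q))
        F = ∑ (L (suc q + n)) (only (suc q))
        F′ = ∑ (L (2 + q + n)) (only (2 + q))
        neutrality : X + Y ≡ Z + W
        neutrality = begin
          X + Y
            ≡⟨ cong (_+ Y) (∑-cong (L (2 + q + n)) (some-middle q)) ⟨
          ∑ (L (2 + q + n)) (some q ∘ middle (q + n)) + Y        ≡⟨ ∑-neutral (q + n) (some q) ⟩
          Z + ∑ (L (suc q + n)) (some q ∘ take (q + n))          ≡⟨ cong (Z +_) (∑-cong (L (suc q + n)) (some-init q)) ⟩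
          Z + W                                                  ∎
        arith₁ : ∀ y x t r → y + ((x + (t + r)) + 1) ≡ (x + y) + (t + r + 1)
        arith₁ = solve-∀
        arith₂ : ∀ z w t r → (z + w) + (t + r + 1) ≡ (w + 1) + (z + t + r)
        arith₂ = solve-∀
        arith₃ : ∀ y r t z t′ r′ → (y + (r + t)) + (z + t′ + r′) ≡ y + ((z + t) + ((r + r′) + t′))
        arith₃ = solve-∀

      M : ℕ
      M = proj₁ (windows w w∈)

      some-M : ∀ m {v} → v ∈ L (m + (M + n)) → someUpTo M (offsets v) ≡ true
      some-M m v∈ with ∈L⇒position v∈
      ... | i , refl with proj₂ (windows w w∈) i
      ... | l , i≤l , l≤i+M , occ = someUpTo⁺ M l∸i≤M (trans
        (offsets-factor i (l ∸ i) (≤-trans (+-monoˡ-≤ n l∸i≤M) (m≤n+m (M + n) m)))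
        (dec-true (_ ≟ᵂ w) (trans (cong (λ j → fac j n) (m+[n∸m]≡n i≤l)) occ)))
        where
        l∸i≤M = m≤n+o⇒m∸n≤o l i l≤i+M

      -- Every factor of length `M + n` contains `w`. So does the tail of every factor of length
      -- `suc M + n`, and the `only` term vanishes. Then `some-count M` reads `C (suc M + n) + 1 = C
      -- (M + n) + returnsUpTo (suc M)`.
      returns-count : returnsUpTo (suc M) ≡ suc K
      returns-count = +-cancelˡ-≡ (C (M + n)) _ _ (begin
        C (M + n) + returnsUpTo (suc M)
          ≡⟨ cong₂ _+_ (all 0) (trans (cong (returnsUpTo (suc M) +_) none) (+-identityʳ _)) ⟨
        ∑ (L (M + n)) (some M) + (returnsUpTo (suc M) + ∑ (L (suc M + n)) (only (suc M)))
          ≡⟨ some-count M ⟨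
        ∑ (L (suc M + n)) (some M) + 1
          ≡⟨ cong (_+ 1) (trans (all 1) (C-suc (M + n))) ⟩
        (K + C (M + n)) + 1
          ≡⟨ arith K (C (M + n)) ⟩
        C (M + n) + suc K ∎)
        where
        open ≡-Reasoning
        arith : ∀ k c → (k + c) + 1 ≡ c + suc k
        arith = solve-∀
        all : ∀ m → ∑ (L (m + (M + n))) (some M) ≡ C (m + (M + n))
        all m = trans (∑-cong (L (m + (M + n))) λ v∈ → cong ⟦_⟧ (some-M m v∈))
          (trans (∑-one (L (m + (M + n)))) (L-length (m + (M + n))))
        none : ∑ (L (suc M + n)) (only (suc M)) ≡ 0
        none = ∑-zero (L (suc M + n)) λ {v} v∈ → cong ⟦_⟧ (begin
          offsets v 0 ∧ not (someUpTo M (offsets v ∘ suc))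
            ≡⟨ cong (λ b → offsets v 0 ∧ not b) (trans (sym (someUpTo-cong M λ p _ → offsets-tail v p)) (some-M 0 (tail∈ v∈))) ⟩
          offsets v 0 ∧ false
            ≡⟨ ∧-false (offsets v 0) ⟩
          false ∎)
          where
          ∧-false : ∀ b → b ∧ false ≡ false
          ∧-false true  = refl
          ∧-false false = refl

      -- Listing the return words.

      complete? : ∀ q → Decidable (λ v → T (firstAndLast q (offsets v)))
      complete? q v = T? (firstAndLast q (offsets v))

      completeReturns newReturns returns : ℕ → List (List A)
      completeReturns q = filter (complete? q) (L (suc q + n))
      newReturns q = map (take (suc q)) (completeReturns q)
      returns zero    = []
      returns (suc q) = returns q ++ newReturns q

      returns-length : ∀ q → length (returns q) ≡ returnsUpTo q
      returns-length zero    = refl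
      returns-length (suc q) = trans (length-++ (returns q)) (cong₂ _+_ (returns-length q)
        (trans (length-map _ (completeReturns q)) (length-filter-T (firstAndLast q ∘ offsets) (L (suc q + n)))))

      completeReturn⁻ : ∀ q {v} → v ∈ completeReturns q →
        ∃[ i ] v ≡ fac i (suc q + n) × SuccessiveOccurrences u w i (i + suc q)
      completeReturn⁻ q v∈ with ∈-filter⁻ (complete? q) {xs = L (suc q + n)} v∈
      ... | v∈L , t with ∈L⇒position v∈L
      ... | i , refl with firstAndLast⁻ q {offsets (fac i (suc q + n))} (Equivalence.to T-≡ t)
      ... | first , none , last = i , refl , m<m+n i (s≤s z≤n) ,
        trans (cong (λ j → fac j n) (sym (+-identityʳ i))) (occurs 0 z≤n first) , occurs (suc q) ≤-refl last , gap
        where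
        occurs : ∀ p → p ≤ suc q → offsets (fac i (suc q + n)) p ≡ true → fac (i + p) n ≡ w
        occurs p p≤ eq = does-true (_ ≟ᵂ w) (trans (sym (offsets-factor i p (+-monoˡ-≤ n p≤))) eq)
        gap : ∀ l → i < l → l < i + suc q → ¬ OccursAt u w l
        gap l i<l l< occ = none p p<q (trans
          (offsets-factor i (suc p) (+-monoˡ-≤ n (<⇒≤ (s≤s p<q))))
          (dec-true (_ ≟ᵂ w) (trans (cong (λ j → fac j n) i+1+p≡l) occ)))
          where
          p = l ∸ suc i
          i+1+p≡l : i + suc p ≡ l
          i+1+p≡l = trans (+-suc i p) (m+[n∸m]≡n i<l)
          p<q : p < q
          p<q = ≤-pred (+-cancelˡ-< i (suc p) (suc q) (subst (_< i + suc q) (sym i+1+p≡l) l<))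

      completeReturn⁺ : ∀ q {i} → SuccessiveOccurrences u w i (i + suc q) → fac i (suc q + n) ∈ completeReturns q
      completeReturn⁺ q {i} (_ , first , last , gap) = ∈-filter⁺ (complete? q) (factorAt∈L i (suc q + n))
        (Equivalence.from T-≡ (firstAndLast⁺ q
          (trans (offsets-factor i 0 (m≤n+m n (suc q)))
            (dec-true (_ ≟ᵂ w) (trans (cong (λ j → fac j n) (+-identityʳ i)) first)))
          (λ p p<q → trans (offsets-factor i (suc p) (+-monoˡ-≤ n (<⇒≤ (s≤s p<q))))
            (dec-false (_ ≟ᵂ w) (gap (i + suc p) (m<m+n i (s≤s z≤n)) (+-monoʳ-< i (s≤s p<q)))))
          (trans (offsets-factor i (suc q) ≤-refl) (dec-true (_ ≟ᵂ w) last))))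

      newReturn⁻ : ∀ q {v} → v ∈ newReturns q → length v ≡ suc q × ReturnWord u w v
      newReturn⁻ q v∈ with ∈-map⁻ (take (suc q)) v∈
      ... | c , c∈ , refl with completeReturn⁻ q c∈
      ... | i , refl , succ =
        trans (cong length prefix) (length-factorAt u i (suc q)) , i , i + suc q , succ ,
        trans prefix (cong (fac i) (sym (m+n∸m≡n i (suc q))))
        where
        prefix : take (suc q) (fac i (suc q + n)) ≡ fac i (suc q)
        prefix = factorAt-prefix u i (m≤m+n (suc q) n)

      newReturn⁺ : ∀ q {i} → SuccessiveOccurrences u w i (i + suc q) → fac i (suc q) ∈ newReturns q
      newReturn⁺ q {i} succ = subst (_∈ newReturns q) (factorAt-prefix u i (m≤m+n (suc q) n))
        (∈-map⁺ (take (suc q)) (completeReturn⁺ q succ))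

      returns⁻ : ∀ q {v} → v ∈ returns q → length v ≤ q × ReturnWord u w v
      returns⁻ (suc q) v∈ with ∈-++⁻ (returns q) v∈
      ... | inj₁ v∈old = Product.map m≤n⇒m≤1+n id (returns⁻ q v∈old)
      ... | inj₂ v∈new = Product.map ≤-reflexive id (newReturn⁻ q v∈new)

      returns⁺ : ∀ {q Q i} → q < Q → SuccessiveOccurrences u w i (i + suc q) → fac i (suc q) ∈ returns Q
      returns⁺ {q} {suc Q} q<1+Q succ with m≤n⇒m<n∨m≡n (≤-pred q<1+Q)
      ... | inj₁ q<Q  = ∈-++⁺ˡ (returns⁺ q<Q succ)
      ... | inj₂ refl = ∈-++⁺ʳ (returns Q) (newReturn⁺ q succ)

      -- Appending `w` to a return word restores its complete return, so truncation is injective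
      -- here.
      newReturns-unique : ∀ q → Unique (newReturns q)
      newReturns-unique q = map⁻ {f = _++ w} (subst Unique
        (sym (trans (sym (map-∘ (completeReturns q))) (map-id-local (All.tabulate complete))))
        (filter⁺ (complete? q) (L-unique (suc q + n))))
        where
        complete : ∀ {v} → v ∈ completeReturns q → take (suc q) v ++ w ≡ v
        complete v∈ with completeReturn⁻ q v∈
        ... | i , refl , _ , _ , occ , _ = trans (cong (take (suc q) (fac i (suc q + n)) ++_) (begin
          w                                       ≡⟨ occ ⟨
          fac (i + suc q) n                       ≡⟨ cong (fac (i + suc q)) (m+n∸m≡n (suc q) n) ⟨
          fac (i + suc q) (suc q + n ∸ suc q)     ≡⟨ factorAt-drop u i (suc q) (suc q + n) ⟨
          drop (suc q) (fac i (suc q + n))        ∎)) (take++drop≡id (suc q) _)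
          where open ≡-Reasoning

      returns-unique : ∀ q → Unique (returns q)
      returns-unique zero    = []
      returns-unique (suc q) = ++⁺ (returns-unique q) (newReturns-unique q) λ (v∈old , v∈new) →
        <⇒≱ (s≤s (proj₁ (returns⁻ q v∈old))) (≤-reflexive (sym (proj₁ (newReturn⁻ q v∈new))))

      ReturnWord-cardinality : HasCardinality (ReturnWord u w) (suc K)
      ReturnWord-cardinality = returns (suc M) , returns-unique (suc M) ,
        trans (returns-length (suc M)) returns-count , λ v → mk⇔ (proj₂ ∘ returns⁻ (suc M)) complete
        where
        complete : ∀ {v} → ReturnWord u w v → v ∈ returns (suc M)
        complete (i , j , succ@(i<j , _ , _ , gap) , refl) =
          subst (λ m → fac i m ∈ returns (suc M)) (sym j∸i≡)
            (returns⁺ q<1+M (subst (SuccessiveOccurrences u w i) j≡ succ))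
          where
          q = j ∸ suc i
          j≡ : j ≡ i + suc q
          j≡ = sym (trans (+-suc i q) (m+[n∸m]≡n i<j))
          j∸i≡ : j ∸ i ≡ suc q
          j∸i≡ = trans (cong (_∸ i) j≡) (m+n∸m≡n i (suc q))
          -- The window starting at `suc i` holds an occurrence, so the next one, `j`, is at most
          -- `suc i + M`.
          q<1+M : q < suc M
          q<1+M with proj₂ (windows w w∈) (suc i)
          ... | l , i<l , l≤ , occ = s≤s (m≤n+o⇒m∸n≤o j (suc i) (≤-trans (≮⇒≥ λ l<j → gap l i<l l<j occ) l≤))

corollary24 : ∀ {a} {A : Set a} (k : ℕ) → A ↔ Fin k →
    (u : ℕ → A) → StrictlySurjective _≡_ u →
    UniformlyRecurrent u →
    (∀ n → Complexity u n ((k ∸ 1) * n + 1)) →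
    UniquePalindromicExtensions u →
    ∀ (w : List A) → Language u w → HasCardinality (ReturnWord u w) k
-- The letter `u 0` rules out an empty alphabet. For `suc K` letters `k ∸ 1` computes to `K`, and
-- equality of letters is decided in `Fin`.
corollary24 zero A↔Fin0 u _ _ _ _ _ _ = contradiction (Inverse.to A↔Fin0 (u 0)) Fin.¬Fin0
corollary24 (suc K) A↔Fin u _ ur complexity unique-extension =
  ReturnWord-cardinality (via-injection (↔⇒↣ A↔Fin) Fin._≟_) u ur K complexity
    λ w lw pal → let v , pe , _ = unique-extension w lw pal in v , pe
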